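{- Let $n,k$ be integers with $k<n<2k$. Then exactly as follows: (1) if $k$ is odd, then $Q_{n/k}$ is a core; (2) if $n<2k-1$ and $k$ is even, then $Q_{(n-1)/(k-1)}$ is the core of $Q_{n/k}$; (3) if $n=2k-1$ and $k$ is even, then $Q_{n/k}$ is homomorphically equivalent to $Q_{(n-1)/(k-1)}$.
   Context: For positive integers $m,j$, $Q_{m/j}$ denotes the Cayley graph on $\mathbb{Z}_2^m$ (group operation bitwise XOR) whose connection set is the set of all elements of weight at least $j$; i.e. vertices are $\mathbb{Z}_2^m$ and $x\sim y$ iff $x+y$ has at least $j$ nonzero coordinates. A homomorphism $G\to H$ is an adjacency-preserving map $V(G)\to V(H)$. A graph is a core if every homomorphism from it to itself is an automorphism; the core of a graph $G$ is the (unique up to isomorphism) vertex-minimal subgraph of $G$ to which $G$ admits a homomorphism. $G$ and $H$ are homomorphically equivalent if $G\to H$ and $H\to G$. -}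

module Defs where

open import Level using (0ℓ)
open import Data.Bool using (Bool; true; false; T; _xor_)
import Data.Bool as Bool
open import Data.Bool.Properties using (xor-comm; xor-same)
open import Data.Fin using (Fin; zero; suc)
open import Data.Fin.Properties using (0↔⊥; 1↔⊤; 2↔Bool; +↔⊎; *↔×)
open import Data.Nat using (ℕ; zero; suc; _+_; _*_; _∸_; _≤_; NonZero; ≢-nonZero⁻¹)
open import Data.Nat.Divisibility using (_∣_; ∣⇒≤)
open import Data.Nat.Properties using (n≤0⇒n≡0; <⇒≱; ≤-refl)
open import Data.Product using (Σ; Σ-syntax; _×_; _,_; proj₁; proj₂)
open import Data.Product.Function.Dependent.Propositional using (Σ-↔)
open import Data.Product.Function.NonDependent.Propositional using (_×-↔_)
open import Data.Sum using (_⊎_; inj₁; inj₂)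
open import Data.Sum.Function.Propositional using (_⊎-↔_)
open import Data.Vec using (Vec; []; _∷_; zipWith; count)
open import Data.Vec.Properties using (zipWith-comm)
open import Function using (_∘_; _↔_; mk↔ₛ′; Bijective)
open import Function.Construct.Composition using (_↔-∘_)
open import Function.Construct.Identity using (↔-id)
open import Function.Bundles using (Inverse)
open import Relation.Binary using (Rel; Symmetric; Irreflexive; _=[_]⇒_)
open import Relation.Binary.PropositionalEquality using (_≡_; refl; cong; subst)
open import Relation.Nullary using (contradiction)

Finite : Set → Set
Finite A = Σ[ n ∈ ℕ ] (Fin n ↔ A)

finite-T : ∀ b → Finite (T b)
finite-T true  = 1 , 1↔⊤
finite-T false = 0 , 0↔⊥

finite-⊎ : ∀ {A B} → Finite A → Finite B → Finite (A ⊎ B)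
finite-⊎ (m , f) (n , g) = m + n , (f ⊎-↔ g) ↔-∘ +↔⊎

finite-× : ∀ {A B} → Finite A → Finite B → Finite (A × B)
finite-× (m , f) (n , g) = m * n , (f ×-↔ g) ↔-∘ *↔×

finite-↔ : ∀ {A B} → A ↔ B → Finite A → Finite B
finite-↔ f (n , g) = n , f ↔-∘ g

finite-ΣFin : ∀ n (p : Fin n → Bool) → Finite (Σ (Fin n) (T ∘ p))
finite-ΣFin zero    p = 0 , mk↔ₛ′ (λ ()) (λ ()) (λ ()) (λ ())
finite-ΣFin (suc n) p =
  finite-↔ split (finite-⊎ (finite-T (p zero)) (finite-ΣFin n (p ∘ suc)))
  where
  split : (T (p zero) ⊎ Σ (Fin n) (T ∘ p ∘ suc)) ↔ Σ (Fin (suc n)) (T ∘ p)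
  split = mk↔ₛ′
    (λ { (inj₁ t) → zero , t ; (inj₂ (i , t)) → suc i , t })
    (λ { (zero , t) → inj₁ t ; (suc i , t) → inj₂ (i , t) })
    (λ { (zero , _) → refl ; (suc _ , _) → refl })
    (λ { (inj₁ _) → refl ; (inj₂ _) → refl })

finite-Σ : ∀ {A} → Finite A → (p : A → Bool) → Finite (Σ A (T ∘ p))
finite-Σ (n , f) p =
  finite-↔ (Σ-↔ f (↔-id _)) (finite-ΣFin n (p ∘ Inverse.to f))

finite-Bits : ∀ m → Finite (Vec Bool m)
finite-Bits zero    =
  1 , mk↔ₛ′ (λ _ → []) (λ _ → zero) (λ { [] → refl }) (λ { zero → refl })
finite-Bits (suc m) = finite-↔ cons (finite-× (2 , 2↔Bool) (finite-Bits m))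
  where
  cons : (Bool × Vec Bool m) ↔ Vec Bool (suc m)
  cons = mk↔ₛ′ (λ { (b , x) → b ∷ x }) (λ { (b ∷ x) → b , x })
               (λ { (_ ∷ _) → refl }) (λ { (_ , _) → refl })

record Graph : Set₁ where
  infix 4 _∼_
  field
    Vertex   : Set
    finite   : Finite Vertex
    _∼_      : Rel Vertex 0ℓ
    ∼-sym    : Symmetric _∼_
    ∼-irrefl : Irreflexive _≡_ _∼_

  order : ℕ
  order = proj₁ finite

open Graph using (Vertex; order)

infix 4 _⟶_ _≅_

record _⟶_ (G H : Graph) : Set where
  field
    map       : Vertex G → Vertex H
    preserves : Graph._∼_ G =[ map ]⇒ Graph._∼_ H

IsIsomorphism : ∀ {G H} → G ⟶ H → Set
IsIsomorphism {G} {H} f =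
  Bijective _≡_ _≡_ map × (∀ {x y} → map x ∼H map y → x ∼G y)
  where
  open _⟶_ f
  open Graph G using () renaming (_∼_ to _∼G_)
  open Graph H using () renaming (_∼_ to _∼H_)

_≅_ : Graph → Graph → Set
G ≅ H = Σ[ f ∈ G ⟶ H ] IsIsomorphism f

HomEquivalent : Graph → Graph → Set
HomEquivalent G H = (G ⟶ H) × (H ⟶ G)

-- Not necessarily induced: edges may be dropped as well as vertices.
record Subgraph (G : Graph) : Set₁ where
  infix 4 _∼ₛ_
  field
    member : Vertex G → Bool
    _∼ₛ_   : Rel (Σ (Vertex G) (T ∘ member)) 0ℓ
    ∼ₛ-sym : Symmetric _∼ₛ_
    ∼ₛ⇒∼   : _∼ₛ_ =[ proj₁ ]⇒ Graph._∼_ G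

  graph : Graph
  graph = record
    { Vertex   = Σ (Vertex G) (T ∘ member)
    ; finite   = finite-Σ (Graph.finite G) member
    ; _∼_      = _∼ₛ_
    ; ∼-sym    = ∼ₛ-sym
    ; ∼-irrefl = λ x≡y x∼y → Graph.∼-irrefl G (cong proj₁ x≡y) (∼ₛ⇒∼ x∼y)
    }

open Subgraph using (graph)

IsCore : Graph → Set
IsCore G = (f : G ⟶ G) → IsIsomorphism f

-- The core is only defined up to isomorphism, so C need only be isomorphic
-- to a vertex-minimal subgraph of G receiving a homomorphism from G.
_IsCoreOf_ : Graph → Graph → Set₁
C IsCoreOf G =
  Σ[ S ∈ Subgraph G ]
    (G ⟶ graph S)
    × ((S′ : Subgraph G) → G ⟶ graph S′ → order (graph S) ≤ order (graph S′))
    × C ≅ graph S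

infixl 6 _⊕_
_⊕_ : ∀ {m} → Vec Bool m → Vec Bool m → Vec Bool m
_⊕_ = zipWith _xor_

weight : ∀ {m} → Vec Bool m → ℕ
weight = count (Bool._≟ true)

weight-⊕-self : ∀ {m} (x : Vec Bool m) → weight (x ⊕ x) ≡ 0
weight-⊕-self []          = refl
weight-⊕-self (true  ∷ x) = weight-⊕-self x
weight-⊕-self (false ∷ x) = weight-⊕-self x

-- Q m j is Q_{m/j}. Every element of ℤ₂^m is its own inverse, so x ⊕ y is the
-- group difference of x and y; j ≥ 1 keeps the identity out of the
-- connection set.
Q : (m j : ℕ) .{{_ : NonZero j}} → Graph
Q m j = record
  { Vertex   = Vec Bool m
  ; finite   = finite-Bits m
  ; _∼_      = λ x y → j ≤ weight (x ⊕ y)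
  ; ∼-sym    = λ {x} {y} → subst (λ z → j ≤ weight z) (zipWith-comm xor-comm x y)
  ; ∼-irrefl = λ { {x} refl j≤w →
      ≢-nonZero⁻¹ j (n≤0⇒n≡0 (subst (j ≤_) (weight-⊕-self x) j≤w)) }
  }

even⇒pred-nonZero : ∀ {k} .{{_ : NonZero k}} → 2 ∣ k → NonZero (k ∸ 1)
even⇒pred-nonZero {suc zero}    2∣1 = contradiction (∣⇒≤ 2∣1) (<⇒≱ ≤-refl)
even⇒pred-nonZero {suc (suc k)} _   = _

{-# OPTIONS --safe #-}
-- Let k be odd, N = n + 1 and K = k + 1. Appending a parity bit to the image of an endomorphism φ of
-- Q_{n/k} and writing its N coordinates as signs gives functions fᵢ : ℤ₂ⁿ → {±1}. Whenever the weight
-- of z is k or K, the lifts of φ x and φ (x ⊕ z) differ in at least K places, so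
-- Σᵢ fᵢ(x) fᵢ(x ⊕ z) ≤ N - 2K. Summed over x and z, this is the opposite of the bound given by the least
-- eigenvalue λ₁ of the Cayley graph with connection set {z : weight z ∈ {k, K}}, so equality holds and
-- every fᵢ lies in the λ₁-eigenspace.
-- The hypothesis k < n < 2k makes λ₁ occur only at the characters indexed by a unit vector or by the
-- all-ones vector. No such index is a nontrivial sum of three others, and a ±1-valued function with
-- Fourier support in such a Sidon set is ± a character. Tightness of the bound then forces every unit
-- vector to occur among these characters, whence φ is injective; on a finite graph this suffices.
-- For k even, the parity bit identifies Q_{(n-1)/(k-1)} with the even-weight part of Q_{n/k}, and
-- forgetting a coordinate maps Q_{n/k} back to it.
module Submission where

open import Defs
open import Algebra.Bundles using (CommutativeRing)
import Algebra.Properties.CommutativeSemigroup as CommutativeSemigroupProperties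
open import Data.Bool.Base using (Bool; true; false; T; not; _∧_; _xor_; if_then_else_)
import Data.Bool.Properties as Bool
open import Data.Fin.Base using (Fin; zero; suc; toℕ)
import Data.Fin.Properties as Fin
import Data.Integer.Properties as ℤ
open import Data.Integer.Tactic.RingSolver using (solve-∀)
open import Data.List.Base using (List; []; _∷_; _++_; allFin; length; map)
open import Data.List.Membership.Propositional using (_∈_; lose)
open import Data.List.Membership.Propositional.Properties
  using (∈-allFin; ∈-map⁺; ∈-++⁺ˡ; ∈-++⁺ʳ)
open import Data.List.Properties using (length-tabulate; map-tabulate)
open import Data.List.Relation.Unary.Any using (any?; here; there; satisfied)
open import Data.Nat.Base as ℕ using (ℕ; NonZero; zero; suc; s≤s; z≤n; _≡ᵇ_)
open import Data.Nat.Divisibility using (_∣_; divides; _∣0; ∣-refl; ∣m∣n⇒∣m+n)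
open import Data.Nat.GeneralisedArithmetic using (fold)
import Data.Nat.Properties as ℕ
open import Data.Product.Base using (∃-syntax; _×_; _,_; proj₁; proj₂; map₂)
import Data.Product.Base as Product
open import Data.Product.Properties using (,-injective)
open import Data.Sum.Base using (_⊎_; inj₁; inj₂)
open import Data.Vec.Base using (Vec; []; _∷_; lookup; replicate; tail)
open import Data.Vec.Properties using (≡-dec; lookup-replicate; lookup-zipWith)
open import Function.Base using (_∘_; id)
open import Function.Bundles using (Injection; Inverse)
open import Function.Definitions using (Injective)
open import Function.Properties.Inverse using (↔-sym; ↔⇒↣)
open import Relation.Binary.PropositionalEquality
open import Relation.Nullary

module Spectral where

  open import Data.Integer.Base hiding (suc; NonZero)
  open import Data.Integer.Properties

  -- Finite sums of integers
  ∑ : ∀ {A : Set} → List A → (A → ℤ) → ℤ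
  ∑ []       f = 0ℤ
  ∑ (x ∷ xs) f = f x + ∑ xs f

  ∑-cong : ∀ {A : Set} (xs : List A) {f g : A → ℤ} → (∀ x → f x ≡ g x) → ∑ xs f ≡ ∑ xs g
  ∑-cong []       f≡g = refl
  ∑-cong (x ∷ xs) f≡g = cong₂ _+_ (f≡g x) (∑-cong xs f≡g)

  ∑-mono : ∀ {A : Set} (xs : List A) {f g : A → ℤ} → (∀ x → f x ≤ g x) → ∑ xs f ≤ ∑ xs g
  ∑-mono []       f≤g = ≤-refl
  ∑-mono (x ∷ xs) f≤g = +-mono-≤ (f≤g x) (∑-mono xs f≤g)

  ∑-+ : ∀ {A : Set} (xs : List A) (f g : A → ℤ) → ∑ xs (λ x → f x + g x) ≡ ∑ xs f + ∑ xs g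
  ∑-+ []       f g = refl
  ∑-+ (x ∷ xs) f g = trans (cong (_+_ (f x + g x)) (∑-+ xs f g)) (interchange (f x) (g x) _ _)
    where
    interchange : ∀ a b c d → a + b + (c + d) ≡ a + c + (b + d)
    interchange = solve-∀

  ∑-*ˡ : ∀ {A : Set} (xs : List A) (c : ℤ) (f : A → ℤ) → ∑ xs (λ x → c * f x) ≡ c * ∑ xs f
  ∑-*ˡ []       c f = sym (*-zeroʳ c)
  ∑-*ˡ (x ∷ xs) c f = trans (cong (_+_ (c * f x)) (∑-*ˡ xs c f)) (sym (*-distribˡ-+ c (f x) _))

  ∑-*ʳ : ∀ {A : Set} (xs : List A) (c : ℤ) (f : A → ℤ) → ∑ xs (λ x → f x * c) ≡ ∑ xs f * c
  ∑-*ʳ xs c f = trans (∑-cong xs (λ x → *-comm (f x) c)) (trans (∑-*ˡ xs c f) (*-comm c _))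

  ∑-- : ∀ {A : Set} (xs : List A) (f g : A → ℤ) → ∑ xs (λ x → f x - g x) ≡ ∑ xs f - ∑ xs g
  ∑-- []       f g = refl
  ∑-- (x ∷ xs) f g = trans (cong (_+_ (f x - g x)) (∑-- xs f g)) (interchange (f x) (g x) _ _)
    where
    interchange : ∀ a b c d → a - b + (c - d) ≡ a + c - (b + d)
    interchange = solve-∀

  ∑-const : ∀ {A : Set} (xs : List A) (c : ℤ) → ∑ xs (λ _ → c) ≡ + length xs * c
  ∑-const []       c = sym (*-zeroˡ c)
  ∑-const (x ∷ xs) c = trans (cong (_+_ c) (∑-const xs c)) (sym (suc-* (+ length xs) c))

  ∑-zero : ∀ {A : Set} (xs : List A) {f : A → ℤ} → (∀ x → f x ≡ 0ℤ) → ∑ xs f ≡ 0ℤ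
  ∑-zero xs f≡0 = trans (∑-cong xs f≡0) (trans (∑-const xs 0ℤ) (*-zeroʳ (+ length xs)))

  ∑-swap : ∀ {A B : Set} (xs : List A) (ys : List B) (f : A → B → ℤ) →
           ∑ xs (λ x → ∑ ys (f x)) ≡ ∑ ys (λ y → ∑ xs (λ x → f x y))
  ∑-swap []       ys f = sym (∑-zero ys (λ _ → refl))
  ∑-swap (x ∷ xs) ys f =
    trans (cong (_+_ (∑ ys (f x))) (∑-swap xs ys f)) (sym (∑-+ ys (f x) _))

  ∑-++ : ∀ {A : Set} (xs ys : List A) (f : A → ℤ) → ∑ (xs ++ ys) f ≡ ∑ xs f + ∑ ys f
  ∑-++ []       ys f = sym (+-identityˡ _)
  ∑-++ (x ∷ xs) ys f = trans (cong (_+_ (f x)) (∑-++ xs ys f)) (sym (+-assoc (f x) _ _))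

  ∑-map : ∀ {A B : Set} (h : A → B) (xs : List A) (f : B → ℤ) → ∑ (map h xs) f ≡ ∑ xs (λ x → f (h x))
  ∑-map h []       f = refl
  ∑-map h (x ∷ xs) f = cong (_+_ (f (h x))) (∑-map h xs f)

  ∑-nonneg : ∀ {A : Set} (xs : List A) {f : A → ℤ} → (∀ {x} → x ∈ xs → 0ℤ ≤ f x) → 0ℤ ≤ ∑ xs f
  ∑-nonneg []       0≤f = ≤-refl
  ∑-nonneg (x ∷ xs) 0≤f = +-mono-≤ (0≤f (here refl)) (∑-nonneg xs (λ y∈ → 0≤f (there y∈)))

  -- Turns an upper bound on a total into equality in every term; the tightness arguments below rest
  -- on it.
  ∑-nonneg-≤0 : ∀ {A : Set} (xs : List A) {f : A → ℤ} → (∀ {x} → x ∈ xs → 0ℤ ≤ f x) →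
                ∑ xs f ≤ 0ℤ → ∀ {x} → x ∈ xs → f x ≡ 0ℤ
  ∑-nonneg-≤0 (x ∷ xs) {f} 0≤f ∑≤0 (here refl) = ≤-antisym fx≤0 (0≤f (here refl))
    where
    fx≤0 : f x ≤ 0ℤ
    fx≤0 = begin
      f x           ≡⟨ +-identityʳ (f x) ⟨
      f x + 0ℤ      ≤⟨ +-monoʳ-≤ (f x) (∑-nonneg xs (λ y∈ → 0≤f (there y∈))) ⟩
      f x + ∑ xs f  ≤⟨ ∑≤0 ⟩
      0ℤ            ∎
      where open ≤-Reasoning
  ∑-nonneg-≤0 (x ∷ xs) {f} 0≤f ∑≤0 (there y∈xs) =
    ∑-nonneg-≤0 xs (λ y∈ → 0≤f (there y∈)) tail≤0 y∈xs
    where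
    tail≤0 : ∑ xs f ≤ 0ℤ
    tail≤0 = begin
      ∑ xs f        ≡⟨ +-identityˡ (∑ xs f) ⟨
      0ℤ + ∑ xs f   ≤⟨ +-monoˡ-≤ (∑ xs f) (0≤f (here refl)) ⟩
      f x + ∑ xs f  ≤⟨ ∑≤0 ⟩
      0ℤ            ∎
      where open ≤-Reasoning

  ∑≢0⇒∃≢0 : ∀ {A : Set} (xs : List A) {f : A → ℤ} → ∑ xs f ≢ 0ℤ → ∃[ x ] f x ≢ 0ℤ
  ∑≢0⇒∃≢0 []           ∑≢0 = contradiction refl ∑≢0
  ∑≢0⇒∃≢0 (x ∷ xs) {f} ∑≢0 with f x ≟ 0ℤ
  ... | no  fx≢0 = x , fx≢0
  ... | yes fx≡0 = ∑≢0⇒∃≢0 xs (λ ∑≡0 → ∑≢0 (cong₂ _+_ fx≡0 ∑≡0))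

  ∑≤0⇒∃<0 : ∀ {A : Set} (xs : List A) {f : A → ℤ} → ∑ xs f ≤ 0ℤ →
            ∀ {x} → x ∈ xs → 0ℤ < f x → ∃[ y ] f y < 0ℤ
  ∑≤0⇒∃<0 xs {f} ∑≤0 x∈xs 0<fx with any? (λ y → f y <? 0ℤ) xs
  ... | yes some = satisfied some
  ... | no  none = contradiction (sym (∑-nonneg-≤0 xs 0≤f ∑≤0 x∈xs)) (<⇒≢ 0<fx)
    where
    0≤f : ∀ {y} → y ∈ xs → 0ℤ ≤ f y
    0≤f y∈xs = ≮⇒≥ (λ fy<0 → none (lose y∈xs fy<0))

  -- Krawtchouk numbers

  -- kraw a b K is the coefficient of t^K in (1 - t)^a (1 + t)^b.
  kraw : ℕ → ℕ → ℕ → ℤ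
  kraw a       b       zero    = 1ℤ
  kraw zero    zero    (suc K) = 0ℤ
  kraw zero    (suc b) (suc K) = kraw zero b (suc K) + kraw zero b K
  kraw (suc a) b       (suc K) = kraw a b (suc K) - kraw a b K

  -- The defining clauses strip a factor `1 + t` only when `a` is zero. The factors commute, so one
  -- can be stripped for every `a`.
  kraw-suc : ∀ a b K → kraw a (suc b) (suc K) ≡ kraw a b (suc K) + kraw a b K
  kraw-suc zero    b K = refl
  kraw-suc (suc a) b zero = trans (cong (_- 1ℤ) (kraw-suc a b 0)) (swap (kraw a b 1) 1ℤ 1ℤ)
    where
    swap : ∀ x y z → x + y - z ≡ x - z + y
    swap = solve-∀
  kraw-suc (suc a) b (suc K) = trans (cong₂ _-_ (kraw-suc a b (suc K)) (kraw-suc a b K))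
    (swap (kraw a b (suc (suc K))) (kraw a b (suc K)) (kraw a b K))
    where
    swap : ∀ x y z → x + y - (y + z) ≡ x - y + (y - z)
    swap = solve-∀

  -- The polynomial has degree `a + b`.
  kraw-vanish : ∀ a b {K} → a ℕ.+ b ℕ.< K → kraw a b K ≡ 0ℤ
  kraw-vanish zero    zero    {suc K} _       = refl
  kraw-vanish zero    (suc b) {suc K} (s≤s p) =
    cong₂ _+_ (kraw-vanish 0 b (ℕ.m≤n⇒m≤1+n p)) (kraw-vanish 0 b p)
  kraw-vanish (suc a) b       {suc K} (s≤s p) =
    cong₂ _-_ (kraw-vanish a b (ℕ.m≤n⇒m≤1+n p)) (kraw-vanish a b p)

  parity : ℕ → ℤ
  parity zero    = 1ℤ
  parity (suc a) = - parity a

  -- Reversing the order of coefficients fixes `1 + t` and negates `1 - t`, so the product is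
  -- palindromic up to the sign `parity a`.
  kraw-sym : ∀ a b K L → K ℕ.+ L ≡ a ℕ.+ b → kraw a b K ≡ parity a * kraw a b L
  kraw-sym zero zero zero zero refl = refl
  kraw-sym zero (suc b) zero (suc L) refl = trans (kraw-sym 0 b 0 L refl)
     (cong (_*_ 1ℤ) (trans (sym (+-identityˡ _)) (cong (_+ kraw 0 b b) (sym (kraw-vanish 0 b ℕ.≤-refl)))))
  kraw-sym zero (suc b) (suc K) zero eq rewrite ℕ.suc-injective (trans (sym (ℕ.+-identityʳ (suc K))) eq) =
    trans
    (cong (_+ kraw 0 b b) (kraw-vanish 0 b ℕ.≤-refl))
    (trans (+-identityˡ _) (kraw-sym 0 b b 0 (ℕ.+-identityʳ b)))
  kraw-sym zero (suc b) (suc K) (suc L) eq = trans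
    (cong₂ _+_ (kraw-sym 0 b (suc K) L (trans (sym (ℕ.+-suc K L)) eq′))
               (kraw-sym 0 b K (suc L) eq′))
    (rearrange 1ℤ (kraw 0 b L) (kraw 0 b (suc L)))
    where
    eq′ = ℕ.suc-injective eq
    rearrange : ∀ s x y → s * x + s * y ≡ s * (y + x)
    rearrange = solve-∀
  kraw-sym (suc a) b zero (suc L) refl = trans (kraw-sym a b 0 (a ℕ.+ b) refl)
    (trans (rearrange (parity a) (kraw a b (a ℕ.+ b)))
      (cong (λ z → - parity a * (z - kraw a b (a ℕ.+ b))) (sym (kraw-vanish a b ℕ.≤-refl))))
    where
    rearrange : ∀ s x → s * x ≡ - s * (0ℤ - x)
    rearrange = solve-∀
  kraw-sym (suc a) b (suc K) zero eq rewrite ℕ.suc-injective (trans (sym (ℕ.+-identityʳ (suc K))) eq) =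
    trans
    (cong (_- kraw a b (a ℕ.+ b)) (kraw-vanish a b ℕ.≤-refl))
    (trans (cong (λ z → 0ℤ - z) (kraw-sym a b (a ℕ.+ b) 0 (ℕ.+-identityʳ _))) (rearrange (parity a) 1ℤ))
    where
    rearrange : ∀ s x → 0ℤ - s * x ≡ - s * x
    rearrange = solve-∀
  kraw-sym (suc a) b (suc K) (suc L) eq = trans
    (cong₂ _-_ (kraw-sym a b (suc K) L (trans (sym (ℕ.+-suc K L)) eq′))
               (kraw-sym a b K (suc L) eq′))
    (rearrange (parity a) (kraw a b L) (kraw a b (suc L)))
    where
    eq′ = ℕ.suc-injective eq
    rearrange : ∀ s x y → s * x - s * y ≡ - s * (y - x)
    rearrange = solve-∀

  parity-dec : ∀ a → parity a ≡ 1ℤ ⊎ parity a ≡ -1ℤ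
  parity-dec zero = inj₁ refl
  parity-dec (suc a) with parity-dec a
  ... | inj₁ even = inj₂ (cong -_ even)
  ... | inj₂ odd  = inj₁ (cong -_ odd)

  parity-double : ∀ K → parity (K ℕ.+ K) ≡ 1ℤ
  parity-double zero = refl
  parity-double (suc K) rewrite ℕ.+-suc K K = trans (neg-involutive (parity (K ℕ.+ K))) (parity-double K)

  -- For odd `a` the polynomial is antipalindromic, so its middle coefficient is its own negative.
  kraw-middle : ∀ a b K → parity a ≡ -1ℤ → K ℕ.+ K ≡ a ℕ.+ b → kraw a b K ≡ 0ℤ
  kraw-middle a b K odd eq = self-negative (trans (kraw-sym a b K K eq)
    (trans (cong (_* kraw a b K) odd) (-1*i≡-i (kraw a b K))))
    where
    self-negative : ∀ {x} → x ≡ - x → x ≡ 0ℤ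
    self-negative {+ zero} _ = refl

  kraw-top : ∀ a b → kraw a b (a ℕ.+ b) ≡ parity a
  kraw-top a b = trans (kraw-sym a b (a ℕ.+ b) 0 (ℕ.+-identityʳ _)) (*-identityʳ (parity a))

  -- `kraw 0 n K` is the binomial coefficient of `n` over `K`.
  kraw-0-pos : ∀ n K → K ℕ.≤ n → 0ℤ < kraw 0 n K
  kraw-0-nonneg : ∀ n K → 0ℤ ≤ kraw 0 n K
  kraw-0-nonneg n       zero    = +≤+ z≤n
  kraw-0-nonneg zero    (suc K) = ≤-refl
  kraw-0-nonneg (suc n) (suc K) = +-mono-≤ (kraw-0-nonneg n (suc K)) (kraw-0-nonneg n K)
  kraw-0-pos n       zero    _         = +<+ (s≤s z≤n)
  kraw-0-pos (suc n) (suc K) (s≤s K≤n) = +-mono-≤-< (kraw-0-nonneg n (suc K)) (kraw-0-pos n K K≤n)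

  ≤-double-pred : ∀ {m} K → 2 ℕ.+ m ℕ.≤ suc K ℕ.+ suc K → m ℕ.≤ K ℕ.+ K
  ≤-double-pred {m} K p = ℕ.≤-pred (ℕ.≤-pred (subst (2 ℕ.+ m ℕ.≤_) (cong suc (ℕ.+-suc K K)) p))

  -- The value is a difference of consecutive binomial coefficients past the middle of row `M`.
  -- Stripping a factor `1 + t` leaves two coefficients past the middle, except that the second may
  -- lie exactly in the middle, where it vanishes.
  kraw-1-nonpos : ∀ M K → 2 ℕ.+ M ℕ.≤ K ℕ.+ K → kraw 1 M K ≤ 0ℤ
  kraw-1-nonpos zero    (suc zero)    _ = -≤+
  kraw-1-nonpos zero    (suc (suc K)) _ = ≤-refl
  kraw-1-nonpos (suc M) (suc K) p = begin
    kraw 1 (suc M) (suc K)       ≡⟨ kraw-suc 1 M K ⟩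
    kraw 1 M (suc K) + kraw 1 M K ≤⟨ +-mono-≤ (kraw-1-nonpos M (suc K) (ℕ.<⇒≤ p)) rest ⟩
    0ℤ                           ∎
    where
    open ≤-Reasoning
    rest : kraw 1 M K ≤ 0ℤ
    rest with ℕ.m≤n⇒m<n∨m≡n (≤-double-pred K p)
    ... | inj₁ 2+M≤2K = kraw-1-nonpos M K 2+M≤2K
    ... | inj₂ 1+M≡2K = ≤-reflexive (kraw-middle 1 M K refl (sym 1+M≡2K))

  -- Least values of Krawtchouk numbers

  infix 4 _≼_
  -- The absolute value of `x` is at most `- y`. This two-sided form survives the negation that
  -- comes with a factor `1 - t`.
  _≼_ : ℤ → ℤ → Set
  x ≼ y = y ≤ x × x ≤ - y

  ≼-refl : ∀ {y} → y ≤ 0ℤ → y ≼ y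
  ≼-refl y≤0 = ≤-refl , ≤-trans y≤0 (neg-mono-≤ y≤0)

  +-mono-≼ : ∀ {x y u v} → x ≼ u → y ≼ v → x + y ≼ u + v
  +-mono-≼ {u = u} {v} (u≤x , x≤-u) (v≤y , y≤-v) =
    +-mono-≤ u≤x v≤y , ≤-trans (+-mono-≤ x≤-u y≤-v) (≤-reflexive (sym (neg-distrib-+ u v)))

  neg-≼ : ∀ {x y} → x ≼ y → - x ≼ y
  neg-≼ {x} {y} (y≤x , x≤-y) =
    ≤-trans (≤-reflexive (sym (neg-involutive y))) (neg-mono-≤ x≤-y) , neg-mono-≤ y≤x

  -- Removing a coordinate of either kind reduces (N , K) to (N - 1 , K) and (N - 1 , K - 1), where
  -- N = a + b + 2. Only for N = 2K - 1 does the second pair violate the hypothesis; there the kind is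
  -- chosen so that the second term is a middle coefficient with a odd, which vanishes.
  kraw-bound : ∀ a b K → 3 ℕ.+ (a ℕ.+ b) ℕ.≤ K ℕ.+ K →
               kraw (suc a) (suc b) K ≼ kraw 1 (suc (a ℕ.+ b)) K
  kraw-bound zero    b K p = ≼-refl (kraw-1-nonpos (suc b) K p)
  kraw-bound (suc a) b (suc K) p with ℕ.m≤n⇒m<n∨m≡n (≤-double-pred K p)
  ... | inj₁ 3+a+b≤2K = subst (kraw (2 ℕ.+ a) (suc b) (suc K) ≼_) (sym (kraw-suc 1 (suc (a ℕ.+ b)) K))
    (+-mono-≼ (kraw-bound a b (suc K) (ℕ.<⇒≤ p)) (neg-≼ (kraw-bound a b K 3+a+b≤2K)))
  ... | inj₂ 2+a+b≡2K with parity-dec (suc a)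
  ...   | inj₂ odd = subst (kraw (2 ℕ.+ a) (suc b) (suc K) ≼_) (sym (kraw-suc 1 (suc (a ℕ.+ b)) K))
    (+-mono-≼ (kraw-bound a b (suc K) (ℕ.<⇒≤ p)) (neg-≼ (subst₂ _≼_
        (sym (kraw-middle (suc a) (suc b) K odd (trans (sym 2+a+b≡2K) (cong suc (sym (ℕ.+-suc a b))))))
        (sym (kraw-middle 1 (suc (a ℕ.+ b)) K refl (sym 2+a+b≡2K)))
        (≼-refl ≤-refl))))
  -- Here `2 + a` equals `K + K`, so `suc a` is odd and the case is void.
  kraw-bound (suc a) zero (suc K) p | inj₂ 2+a+b≡2K | inj₁ even =
    contradiction (trans (sym (trans
      (cong parity (trans (cong (2 ℕ.+_) (sym (ℕ.+-identityʳ a))) 2+a+b≡2K)) (parity-double K)))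
      (cong -_ even)) (λ ())
  kraw-bound (suc a) (suc b) (suc K) p | inj₂ 2+a+b≡2K | inj₁ even =
    subst₂ _≼_ (sym (kraw-suc (2 ℕ.+ a) (suc b) K)) (sym (kraw-suc 1 (suc (a ℕ.+ suc b)) K))
      (+-mono-≼
        (subst (λ m → kraw (2 ℕ.+ a) (suc b) (suc K) ≼ kraw 1 (suc m) (suc K)) (sym (ℕ.+-suc a b))
          (kraw-bound (suc a) b (suc K) (subst (λ m → 3 ℕ.+ m ℕ.≤ suc K ℕ.+ suc K) (ℕ.+-suc a b)
            (ℕ.<⇒≤ p))))
        (subst₂ _≼_
          (sym (kraw-middle (2 ℕ.+ a) (suc b) K (cong -_ even) (sym 2+a+b≡2K)))
          (sym (kraw-middle 1 (suc (a ℕ.+ suc b)) K refl (sym 2+a+b≡2K)))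
          (≼-refl ≤-refl)))

  -- Stripping `1 + t` on both sides splits each into two coefficients. One pair is strictly ordered
  -- by hypothesis, and `kraw-bound` compares the other. `kraw-strict-left` strips `1 - t` from the
  -- larger side instead.
  kraw-strict-right : ∀ a b K → 4 ℕ.+ (a ℕ.+ b) ℕ.≤ K ℕ.+ K →
    kraw 1 (2 ℕ.+ (a ℕ.+ b)) (suc K) < kraw (2 ℕ.+ a) (suc b) (suc K) →
    kraw 1 (3 ℕ.+ (a ℕ.+ b)) (suc K) < kraw (2 ℕ.+ a) (2 ℕ.+ b) (suc K)
  kraw-strict-right a b K p lt =
    subst₂ _<_ (sym (kraw-suc 1 (2 ℕ.+ (a ℕ.+ b)) K)) (sym (kraw-suc (2 ℕ.+ a) (suc b) K))
      (+-mono-<-≤ lt (proj₁ (kraw-bound (suc a) b K p)))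

  kraw-strict-left : ∀ a b K → 4 ℕ.+ (a ℕ.+ b) ℕ.≤ K ℕ.+ K →
    kraw 1 (2 ℕ.+ (a ℕ.+ b)) (suc K) < kraw (suc a) (2 ℕ.+ b) (suc K) →
    kraw 1 (3 ℕ.+ (a ℕ.+ b)) (suc K) < kraw (2 ℕ.+ a) (2 ℕ.+ b) (suc K)
  kraw-strict-left a b K p lt =
    subst (_< kraw (2 ℕ.+ a) (2 ℕ.+ b) (suc K)) (sym (kraw-suc 1 (2 ℕ.+ (a ℕ.+ b)) K))
      (+-mono-<-≤ lt (proj₁ (neg-≼ bound)))
    where
    bound : kraw (suc a) (2 ℕ.+ b) K ≼ kraw 1 (2 ℕ.+ (a ℕ.+ b)) K
    bound = subst (λ m → kraw (suc a) (2 ℕ.+ b) K ≼ kraw 1 (suc m) K) (ℕ.+-suc a b)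
      (kraw-bound a (suc b) K (subst (λ m → 3 ℕ.+ m ℕ.≤ K ℕ.+ K) (sym (ℕ.+-suc a b)) p))

  -- Induction on `a + b` with `K` fixed, down to `K ≡ 3 + (a + b)`. There, stripping one factor
  -- leaves leading coefficients: -1 for `kraw 1`, and 1 for the other polynomial once the kind of
  -- factor is chosen by the parity of `a`.
  kraw-strict : ∀ a b K → K ℕ.≤ 3 ℕ.+ (a ℕ.+ b) → 6 ℕ.+ (a ℕ.+ b) ℕ.≤ K ℕ.+ K →
                kraw 1 (3 ℕ.+ (a ℕ.+ b)) K < kraw (2 ℕ.+ a) (2 ℕ.+ b) K
  kraw-strict a b (suc K) K≤ p with ℕ.m≤n⇒m<n∨m≡n K≤
  kraw-strict a b (suc K) K≤ p | inj₂ refl with parity-dec a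
  ... | inj₁ even = kraw-strict-right a b K (≤-double-pred K p)
    (subst₂ _<_ (sym (kraw-top 1 K)) (sym right≡1) -<+)
    where
    right≡1 : kraw (2 ℕ.+ a) (suc b) (suc K) ≡ 1ℤ
    right≡1 = begin
      kraw (2 ℕ.+ a) (suc b) (3 ℕ.+ (a ℕ.+ b))
        ≡⟨ cong (λ m → kraw (2 ℕ.+ a) (suc b) (2 ℕ.+ m)) (ℕ.+-suc a b) ⟨
      kraw (2 ℕ.+ a) (suc b) (2 ℕ.+ a ℕ.+ suc b)  ≡⟨ kraw-top (2 ℕ.+ a) (suc b) ⟩
      - - parity a                                ≡⟨ neg-involutive (parity a) ⟩
      parity a                                    ≡⟨ even ⟩
      1ℤ                                          ∎
      where open ≡-Reasoning
  ... | inj₂ odd = kraw-strict-left a b K (≤-double-pred K p)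
    (subst₂ _<_ (sym (kraw-top 1 K)) (sym left≡1) -<+)
    where
    left≡1 : kraw (suc a) (2 ℕ.+ b) (suc K) ≡ 1ℤ
    left≡1 = begin
      kraw (suc a) (2 ℕ.+ b) (3 ℕ.+ (a ℕ.+ b))
        ≡⟨ cong (λ m → kraw (suc a) (2 ℕ.+ b) (suc m))
          (trans (ℕ.+-suc a (suc b)) (cong suc (ℕ.+-suc a b))) ⟨
      kraw (suc a) (2 ℕ.+ b) (suc a ℕ.+ (2 ℕ.+ b))  ≡⟨ kraw-top (suc a) (2 ℕ.+ b) ⟩
      - parity a                                  ≡⟨ cong -_ odd ⟩
      1ℤ                                          ∎
      where open ≡-Reasoning
  kraw-strict zero zero (suc K) K≤ p | inj₁ (s≤s K≤2) =
    contradiction (ℕ.≤-trans p (ℕ.+-mono-≤ K≤2 K≤2)) (λ { (s≤s (s≤s (s≤s (s≤s ())))) })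
  kraw-strict (suc a) zero (suc K) K≤ p | inj₁ (s≤s K≤2+a+b) =
    kraw-strict-left (suc a) zero K (≤-double-pred K p)
      (kraw-strict a zero (suc K) K≤2+a+b (ℕ.<⇒≤ p))
  kraw-strict a (suc b) (suc K) K≤ p | inj₁ (s≤s K≤2+a+b) =
    kraw-strict-right a (suc b) K (≤-double-pred K p)
      (subst (λ m → kraw 1 (2 ℕ.+ m) (suc K) < kraw (2 ℕ.+ a) (2 ℕ.+ b) (suc K)) (sym (ℕ.+-suc a b))
        (kraw-strict a b (suc K)
          (subst (λ m → suc K ℕ.≤ 2 ℕ.+ m) (ℕ.+-suc a b) K≤2+a+b)
          (subst (λ m → 5 ℕ.+ m ℕ.≤ suc K ℕ.+ suc K) (ℕ.+-suc a b) (ℕ.<⇒≤ p))))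

  -- The absorption identity for binomial coefficients.
  kraw-absorb : ∀ n K → + suc K * kraw 0 (suc n) (suc K) ≡ + suc n * kraw 0 n K
  kraw-absorb zero    zero    = refl
  kraw-absorb zero    (suc K) = *-zeroʳ (+ suc (suc K))
  kraw-absorb (suc n) zero    = trans (*-distribˡ-+ 1ℤ (kraw 0 (suc n) 1) 1ℤ)
    (trans (cong (_+ 1ℤ) (kraw-absorb n 0)) (+-comm (+ suc n * 1ℤ) 1ℤ))
  kraw-absorb (suc n) (suc K) = begin
    + suc (suc K) * (x + y)                      ≡⟨ expand (+ suc K) x y ⟩
    + suc (suc K) * x + (+ suc K * y + y)
      ≡⟨ cong₂ (λ s t → s + (t + y)) (kraw-absorb n (suc K)) (kraw-absorb n K) ⟩
    + suc n * u + (+ suc n * v + (u + v))        ≡⟨ collect (+ suc n) u v ⟩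
    + suc (suc n) * (u + v)                      ∎
    where
    open ≡-Reasoning
    x = kraw 0 (suc n) (suc (suc K))
    y = kraw 0 (suc n) (suc K)
    u = kraw 0 n (suc K)
    v = kraw 0 n K
    expand : ∀ k x y → (1ℤ + k) * (x + y) ≡ (1ℤ + k) * x + (k * y + y)
    expand = solve-∀
    collect : ∀ m u v → m * u + (m * v + (u + v)) ≡ (1ℤ + m) * (u + v)
    collect = solve-∀

  -- With N = M + 1, the ratio of `kraw 1 M K` to the binomial coefficient of N over `K` is (N - 2K)
  -- / N. This is why the spectral and the combinatorial bounds coincide.
  kraw-1-eigenvalue : ∀ M K → + suc M * kraw 1 M K ≡ (+ suc M - (+ K + + K)) * kraw 0 (suc M) K
  kraw-1-eigenvalue M zero    = cong (_* 1ℤ) (sym (+-identityʳ (+ suc M)))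
  kraw-1-eigenvalue M (suc K) = begin
    + suc M * (u - v)                                           ≡⟨ expand (+ suc M) u v ⟩
    + suc M * (u + v) - (+ suc M * v + + suc M * v)
      ≡⟨ cong (λ t → + suc M * (u + v) - (t + t)) (sym (kraw-absorb M K)) ⟩
    + suc M * (u + v) - (+ suc K * (u + v) + + suc K * (u + v)) ≡⟨ collect (+ suc M) (+ suc K) (u + v) ⟩
    (+ suc M - (+ suc K + + suc K)) * (u + v)                   ∎
    where
    open ≡-Reasoning
    u = kraw 0 M (suc K)
    v = kraw 0 M K
    expand : ∀ m u v → m * (u - v) ≡ m * (u + v) - (m * v + m * v)
    expand = solve-∀
    collect : ∀ m k w → m * w - (k * w + k * w) ≡ (m - (k + k)) * w
    collect = solve-∀

  -- Fourier analysis on ℤ₂ⁿ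

  𝟎 : ∀ {n} → Vec Bool n
  𝟎 = replicate _ false

  _≟ᵛ_ : ∀ {n} (x y : Vec Bool n) → Dec (x ≡ y)
  _≟ᵛ_ = ≡-dec Bool._≟_

  ⊕-cancelˡ : ∀ {n} (x y : Vec Bool n) → x ⊕ (x ⊕ y) ≡ y
  ⊕-cancelˡ []          []      = refl
  ⊕-cancelˡ (true  ∷ x) (b ∷ y) = cong₂ _∷_ (Bool.not-involutive b) (⊕-cancelˡ x y)
  ⊕-cancelˡ (false ∷ x) (b ∷ y) = cong (b ∷_) (⊕-cancelˡ x y)

  ⊕-comm : ∀ {n} (x y : Vec Bool n) → x ⊕ y ≡ y ⊕ x
  ⊕-comm []      []      = refl
  ⊕-comm (b ∷ x) (c ∷ y) = cong₂ _∷_ (Bool.xor-comm b c) (⊕-comm x y)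

  ⊕-identityʳ : ∀ {n} (x : Vec Bool n) → x ⊕ 𝟎 ≡ x
  ⊕-identityʳ []      = refl
  ⊕-identityʳ (b ∷ x) = cong₂ _∷_ (Bool.xor-identityʳ b) (⊕-identityʳ x)

  ⊕≡𝟎⇒≡ : ∀ {n} (x y : Vec Bool n) → x ⊕ y ≡ 𝟎 → x ≡ y
  ⊕≡𝟎⇒≡ x y x⊕y≡𝟎 = trans (sym (⊕-identityʳ x)) (trans (cong (x ⊕_) (sym x⊕y≡𝟎)) (⊕-cancelˡ x y))

  sgn : Bool → ℤ
  sgn false = 1ℤ
  sgn true  = -1ℤ

  sgn-xor : ∀ b c → sgn (b xor c) ≡ sgn b * sgn c
  sgn-xor false false = refl
  sgn-xor false true  = refl
  sgn-xor true  false = refl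
  sgn-xor true  true  = refl

  χ : ∀ {n} → Vec Bool n → Vec Bool n → ℤ
  χ []      []      = 1ℤ
  χ (s ∷ S) (b ∷ x) = sgn (s ∧ b) * χ S x

  *-interchange : ∀ a b c d → a * b * (c * d) ≡ a * c * (b * d)
  *-interchange = solve-∀

  χ-⊕ʳ : ∀ {n} (S x y : Vec Bool n) → χ S (x ⊕ y) ≡ χ S x * χ S y
  χ-⊕ʳ []      []      []      = refl
  χ-⊕ʳ (s ∷ S) (b ∷ x) (c ∷ y) = begin
    sgn (s ∧ (b xor c)) * χ S (x ⊕ y)
      ≡⟨ cong₂ (λ t u → sgn t * u) (Bool.∧-distribˡ-xor s b c) (χ-⊕ʳ S x y) ⟩
    sgn ((s ∧ b) xor (s ∧ c)) * (χ S x * χ S y)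
      ≡⟨ cong (_* (χ S x * χ S y)) (sgn-xor (s ∧ b) (s ∧ c)) ⟩
    sgn (s ∧ b) * sgn (s ∧ c) * (χ S x * χ S y)
      ≡⟨ *-interchange (sgn (s ∧ b)) (sgn (s ∧ c)) (χ S x) (χ S y) ⟩
    sgn (s ∧ b) * χ S x * (sgn (s ∧ c) * χ S y)     ∎
    where open ≡-Reasoning

  χ-sym : ∀ {n} (S x : Vec Bool n) → χ S x ≡ χ x S
  χ-sym []      []      = refl
  χ-sym (s ∷ S) (b ∷ x) = cong₂ (λ t u → sgn t * u) (Bool.∧-comm s b) (χ-sym S x)

  χ-⊕ˡ : ∀ {n} (S T x : Vec Bool n) → χ (S ⊕ T) x ≡ χ S x * χ T x
  χ-⊕ˡ S T x = trans (χ-sym (S ⊕ T) x) (trans (χ-⊕ʳ x S T) (cong₂ _*_ (χ-sym x S) (χ-sym x T)))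

  χ-𝟎ʳ : ∀ {n} (S : Vec Bool n) → χ S 𝟎 ≡ 1ℤ
  χ-𝟎ʳ []      = refl
  χ-𝟎ʳ (s ∷ S) = cong₂ (λ t u → sgn t * u) (Bool.∧-zeroʳ s) (χ-𝟎ʳ S)

  sgn-square : ∀ b → sgn b * sgn b ≡ 1ℤ
  sgn-square false = refl
  sgn-square true  = refl

  χ-square : ∀ {n} (S x : Vec Bool n) → χ S x * χ S x ≡ 1ℤ
  χ-square []      []      = refl
  χ-square (s ∷ S) (b ∷ x) =
    trans (*-interchange (sgn (s ∧ b)) (χ S x) (sgn (s ∧ b)) (χ S x))
      (cong₂ _*_ (sgn-square (s ∧ b)) (χ-square S x))

  cube : ∀ n → List (Vec Bool n)
  cube zero    = [] ∷ []
  cube (suc n) = map (false ∷_) (cube n) ++ map (true ∷_) (cube n)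

  ∈-cube : ∀ {n} (x : Vec Bool n) → x ∈ cube n
  ∈-cube []          = here refl
  ∈-cube (false ∷ x) = ∈-++⁺ˡ (∈-map⁺ (false ∷_) (∈-cube x))
  ∈-cube (true  ∷ x) = ∈-++⁺ʳ (map (false ∷_) (cube _)) (∈-map⁺ (true ∷_) (∈-cube x))

  ∑-cube-suc : ∀ {n} (f : Vec Bool (suc n) → ℤ) →
               ∑ (cube (suc n)) f ≡ ∑ (cube n) (λ x → f (false ∷ x)) + ∑ (cube n) (λ x → f (true ∷ x))
  ∑-cube-suc {n} f = trans (∑-++ (map (false ∷_) (cube n)) _ f)
    (cong₂ _+_ (∑-map (false ∷_) (cube n) f) (∑-map (true ∷_) (cube n) f))

  ∑-shift : ∀ {n} (z : Vec Bool n) (f : Vec Bool n → ℤ) →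
            ∑ (cube n) (λ x → f (x ⊕ z)) ≡ ∑ (cube n) f
  ∑-shift []          f = refl
  ∑-shift (false ∷ z) f = trans (∑-cube-suc (λ x → f (x ⊕ (false ∷ z))))
    (trans (cong₂ _+_ (∑-shift z (λ x → f (false ∷ x))) (∑-shift z (λ x → f (true ∷ x))))
           (sym (∑-cube-suc f)))
  ∑-shift (true  ∷ z) f = trans (∑-cube-suc (λ x → f (x ⊕ (true ∷ z))))
    (trans (cong₂ _+_ (∑-shift z (λ x → f (true ∷ x))) (∑-shift z (λ x → f (false ∷ x))))
           (trans (+-comm (∑ (cube _) (λ x → f (true ∷ x))) _) (sym (∑-cube-suc f))))

  -- At a coordinate where `S` is true, the two halves of the cube cancel.
  ∑-χ : ∀ {n} (S : Vec Bool n) → S ≢ 𝟎 → ∑ (cube n) (χ S) ≡ 0ℤ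
  ∑-χ []          S≢𝟎 = contradiction refl S≢𝟎
  ∑-χ {suc n} (false ∷ S) S≢𝟎 = begin
    ∑ (cube (suc n)) (χ (false ∷ S))
      ≡⟨ ∑-cube-suc (χ (false ∷ S)) ⟩
    ∑ (cube n) (λ x → 1ℤ * χ S x) + ∑ (cube n) (λ x → 1ℤ * χ S x)          ≡⟨ cong₂ _+_ half≡0 half≡0 ⟩
    0ℤ                                                                      ∎
    where
    open ≡-Reasoning
    half≡0 : ∑ (cube n) (λ x → 1ℤ * χ S x) ≡ 0ℤ
    half≡0 = trans (∑-*ˡ (cube n) 1ℤ (χ S)) (cong (1ℤ *_) (∑-χ S (λ S≡𝟎 → S≢𝟎 (cong (false ∷_) S≡𝟎))))
  ∑-χ {suc n} (true ∷ S) S≢𝟎 = begin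
    ∑ (cube (suc n)) (χ (true ∷ S))                                         ≡⟨ ∑-cube-suc (χ (true ∷ S)) ⟩
    ∑ (cube n) (λ x → 1ℤ * χ S x) + ∑ (cube n) (λ x → -1ℤ * χ S x)
      ≡⟨ cong₂ _+_ (∑-*ˡ (cube n) 1ℤ (χ S)) (∑-*ˡ (cube n) -1ℤ (χ S)) ⟩
    1ℤ * ∑ (cube n) (χ S) + -1ℤ * ∑ (cube n) (χ S)
      ≡⟨ *-distribʳ-+ (∑ (cube n) (χ S)) 1ℤ -1ℤ ⟨
    0ℤ * ∑ (cube n) (χ S)
      ≡⟨ *-zeroˡ (∑ (cube n) (χ S)) ⟩
    0ℤ                                                                      ∎
    where open ≡-Reasoning

  -- Unnormalised, so that all coefficients are integers; inversion and Plancherel carry the factor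
  -- 2^n.
  fourier : ∀ {n} → (Vec Bool n → ℤ) → Vec Bool n → ℤ
  fourier {n} f S = ∑ (cube n) (λ x → f x * χ S x)

  fourier-∷ : ∀ {n} (f : Vec Bool (suc n) → ℤ) s (S : Vec Bool n) →
              fourier f (s ∷ S) ≡ fourier (λ x → f (false ∷ x)) S + sgn s * fourier (λ x → f (true ∷ x)) S
  fourier-∷ {n} f s S = trans (∑-cube-suc (λ x → f x * χ (s ∷ S) x)) (cong₂ _+_
    (∑-cong (cube n) (λ x → cong (f (false ∷ x) *_)
      (trans (cong (λ t → sgn t * χ S x) (Bool.∧-zeroʳ s)) (*-identityˡ (χ S x)))))
    (trans (∑-cong (cube n) (λ x → trans
      (cong (λ t → f (true ∷ x) * (sgn t * χ S x)) (Bool.∧-identityʳ s))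
      (swap (f (true ∷ x)) (sgn s) (χ S x))))
           (∑-*ˡ (cube n) (sgn s) (λ x → f (true ∷ x) * χ S x))))
    where
    swap : ∀ a b c → a * (b * c) ≡ b * (a * c)
    swap = solve-∀

  -- By induction: combining the coefficients at `false ∷ S` and `true ∷ S` with the sign of `b`
  -- isolates twice the coefficient of the restriction of `f` to first bit `b`.
  fourier-inversion : ∀ {n} (f : Vec Bool n → ℤ) (y : Vec Bool n) →
                      ∑ (cube n) (λ S → fourier f S * χ S y) ≡ (+ 2) ^ n * f y
  fourier-inversion f [] = simplify (f [])
    where
    simplify : ∀ a → (a * 1ℤ + 0ℤ) * 1ℤ + 0ℤ ≡ 1ℤ * a
    simplify = solve-∀
  fourier-inversion {suc n} f (b ∷ y) = begin
    ∑ (cube (suc n)) (λ S → fourier f S * χ S (b ∷ y))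
      ≡⟨ ∑-cube-suc (λ S → fourier f S * χ S (b ∷ y)) ⟩
    ∑ (cube n) (λ S → fourier f (false ∷ S) * (1ℤ * χ S y)) + ∑ (cube n)
      (λ S → fourier f (true ∷ S) * (sgn b * χ S y))
      ≡⟨ ∑-+ (cube n) (λ S → fourier f (false ∷ S) * (1ℤ * χ S y))
        (λ S → fourier f (true ∷ S) * (sgn b * χ S y)) ⟨
    ∑ (cube n) (λ S → fourier f (false ∷ S) * (1ℤ * χ S y) + fourier f (true ∷ S) * (sgn b * χ S y))
      ≡⟨ ∑-cong (cube n) (λ S → trans
        (cong₂ (λ t u → t * (1ℤ * χ S y) + u * (sgn b * χ S y)) (fourier-∷ f false S)
        (fourier-∷ f true S)) (collect b S)) ⟩
    ∑ (cube n) (λ S → + 2 * (fourier (λ x → f (b ∷ x)) S * χ S y))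
      ≡⟨ ∑-*ˡ (cube n) (+ 2) (λ S → fourier (λ x → f (b ∷ x)) S * χ S y) ⟩
    + 2 * ∑ (cube n) (λ S → fourier (λ x → f (b ∷ x)) S * χ S y)
      ≡⟨ cong (+ 2 *_) (fourier-inversion (λ x → f (b ∷ x)) y) ⟩
    + 2 * ((+ 2) ^ n * f (b ∷ y))
      ≡⟨ *-assoc (+ 2) ((+ 2) ^ n) (f (b ∷ y)) ⟨
    (+ 2) ^ suc n * f (b ∷ y) ∎
    where
    open ≡-Reasoning
    F₀ F₁ : Vec Bool n → ℤ
    F₀ = fourier (λ x → f (false ∷ x))
    F₁ = fourier (λ x → f (true ∷ x))
    collect₀ : ∀ u v c → (u + 1ℤ * v) * (1ℤ * c) + (u + -1ℤ * v) * (1ℤ * c) ≡ + 2 * (u * c)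
    collect₀ = solve-∀
    collect₁ : ∀ u v c → (u + 1ℤ * v) * (1ℤ * c) + (u + -1ℤ * v) * (-1ℤ * c) ≡ + 2 * (v * c)
    collect₁ = solve-∀
    collect : ∀ b S → (F₀ S + 1ℤ * F₁ S) * (1ℤ * χ S y) + (F₀ S + -1ℤ * F₁ S) * (sgn b * χ S y)
                    ≡ + 2 * (fourier (λ x → f (b ∷ x)) S * χ S y)
    collect false S = collect₀ (F₀ S) (F₁ S) (χ S y)
    collect true  S = collect₁ (F₀ S) (F₁ S) (χ S y)

  plancherel : ∀ {n} (f g : Vec Bool n → ℤ) →
               ∑ (cube n) (λ S → fourier f S * fourier g S) ≡ (+ 2) ^ n * ∑ (cube n) (λ x → f x * g x)
  plancherel {n} f g = begin
    ∑ (cube n) (λ S → fourier f S * fourier g S)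
      ≡⟨ ∑-cong (cube n) (λ S → ∑-*ˡ (cube n) (fourier f S) (λ x → g x * χ S x)) ⟨
    ∑ (cube n) (λ S → ∑ (cube n) (λ x → fourier f S * (g x * χ S x)))
      ≡⟨ ∑-swap (cube n) (cube n) (λ S x → fourier f S * (g x * χ S x)) ⟩
    ∑ (cube n) (λ x → ∑ (cube n) (λ S → fourier f S * (g x * χ S x)))
      ≡⟨ ∑-cong (cube n) pointwise ⟩
    ∑ (cube n) (λ x → (+ 2) ^ n * (f x * g x))
      ≡⟨ ∑-*ˡ (cube n) ((+ 2) ^ n) (λ x → f x * g x) ⟩
    (+ 2) ^ n * ∑ (cube n) (λ x → f x * g x) ∎
    where
    open ≡-Reasoning
    swap : ∀ a b c → a * (b * c) ≡ b * (a * c)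
    swap = solve-∀
    pointwise : ∀ x → ∑ (cube n) (λ S → fourier f S * (g x * χ S x)) ≡ (+ 2) ^ n * (f x * g x)
    pointwise x = begin
      ∑ (cube n) (λ S → fourier f S * (g x * χ S x))
        ≡⟨ ∑-cong (cube n) (λ S → swap (fourier f S) (g x) (χ S x)) ⟩
      ∑ (cube n) (λ S → g x * (fourier f S * χ S x))  ≡⟨ ∑-*ˡ (cube n) (g x) (λ S → fourier f S * χ S x) ⟩
      g x * ∑ (cube n) (λ S → fourier f S * χ S x)    ≡⟨ cong (g x *_) (fourier-inversion f x) ⟩
      g x * ((+ 2) ^ n * f x)                         ≡⟨ swap (g x) ((+ 2) ^ n) (f x) ⟩
      (+ 2) ^ n * (g x * f x)                         ≡⟨ cong ((+ 2) ^ n *_) (*-comm (g x) (f x)) ⟩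
      (+ 2) ^ n * (f x * g x)                         ∎

  -- When `w` is the indicator of a connection set, this is the adjacency operator of the Cayley
  -- graph.
  convolve : ∀ {n} → (Vec Bool n → ℤ) → (Vec Bool n → ℤ) → Vec Bool n → ℤ
  convolve {n} w f x = ∑ (cube n) (λ z → w z * f (x ⊕ z))

  -- The characters diagonalise convolution by `w`, with eigenvalues `fourier w S`.
  fourier-convolve : ∀ {n} (w f : Vec Bool n → ℤ) S → fourier (convolve w f) S ≡ fourier w S * fourier f S
  fourier-convolve {n} w f S = begin
    ∑ (cube n) (λ x → convolve w f x * χ S x)
      ≡⟨ ∑-cong (cube n) (λ x → sym (∑-*ʳ (cube n) (χ S x) (λ z → w z * f (x ⊕ z)))) ⟩
    ∑ (cube n) (λ x → ∑ (cube n) (λ z → w z * f (x ⊕ z) * χ S x))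
      ≡⟨ ∑-swap (cube n) (cube n) (λ x z → w z * f (x ⊕ z) * χ S x) ⟩
    ∑ (cube n) (λ z → ∑ (cube n) (λ x → w z * f (x ⊕ z) * χ S x))
      ≡⟨ ∑-cong (cube n) inner ⟩
    ∑ (cube n) (λ z → w z * χ S z * fourier f S)
      ≡⟨ ∑-*ʳ (cube n) (fourier f S) (λ z → w z * χ S z) ⟩
    fourier w S * fourier f S ∎
    where
    open ≡-Reasoning
    χ-cancel : ∀ x z → χ S x ≡ χ S z * χ S (x ⊕ z)
    χ-cancel x z = begin
      χ S x                        ≡⟨ cong (χ S) (⊕-cancelˡ z x) ⟨
      χ S (z ⊕ (z ⊕ x))            ≡⟨ cong (λ t → χ S (z ⊕ t)) (⊕-comm z x) ⟩
      χ S (z ⊕ (x ⊕ z))            ≡⟨ χ-⊕ʳ S z (x ⊕ z) ⟩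
      χ S z * χ S (x ⊕ z)          ∎
    inner : ∀ z → ∑ (cube n) (λ x → w z * f (x ⊕ z) * χ S x) ≡ w z * χ S z * fourier f S
    inner z = begin
      ∑ (cube n) (λ x → w z * f (x ⊕ z) * χ S x)
        ≡⟨ ∑-cong (cube n) (λ x → trans (cong (w z * f (x ⊕ z) *_) (χ-cancel x z))
          (*-interchange (w z) (f (x ⊕ z)) (χ S z) (χ S (x ⊕ z)))) ⟩
      ∑ (cube n) (λ x → w z * χ S z * (f (x ⊕ z) * χ S (x ⊕ z)))
        ≡⟨ ∑-*ˡ (cube n) (w z * χ S z) (λ x → f (x ⊕ z) * χ S (x ⊕ z)) ⟩
      w z * χ S z * ∑ (cube n) (λ x → f (x ⊕ z) * χ S (x ⊕ z))
        ≡⟨ cong (w z * χ S z *_) (∑-shift z (λ x → f x * χ S x)) ⟩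
      w z * χ S z * fourier f S ∎

  fourier-*χ : ∀ {n} (f : Vec Bool n → ℤ) S T → fourier (λ x → f x * χ S x) T ≡ fourier f (T ⊕ S)
  fourier-*χ {n} f S T = ∑-cong (cube n)
    (λ x → trans (swap (f x) (χ S x) (χ T x)) (cong (f x *_) (sym (χ-⊕ˡ T S x))))
    where
    swap : ∀ a b c → a * b * c ≡ a * (c * b)
    swap = solve-∀

  -- Sign-valued functions with Fourier support in a Sidon set

  square-nonneg : ∀ a → 0ℤ ≤ a * a
  square-nonneg (+ n)    = ≤-trans (+≤+ z≤n) (≤-reflexive (pos-* n n))
  square-nonneg -[1+ n ] = +≤+ z≤n

  square≡0 : ∀ {a} → a * a ≡ 0ℤ → a ≡ 0ℤ
  square≡0 {a} a²≡0 with i*j≡0⇒i≡0∨j≡0 a a²≡0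
  ... | inj₁ a≡0 = a≡0
  ... | inj₂ a≡0 = a≡0

  -- For distinct `a` and `b` in `B`, the sum `a ⊕ b` determines the unordered pair among the pairs
  -- in `B`.
  Sidon : ∀ {n} → (Vec Bool n → Set) → Set
  Sidon B = ∀ {a b c} → B a → B b → B c → a ≢ b → c ≢ a → c ≢ b → ¬ B (c ⊕ (a ⊕ b))

  -- The (a ⊕ b)-th Fourier coefficient of f² ≡ 1 vanishes; expanded as a convolution of f̂ with itself,
  -- it retains only the terms at a and at b.
  sidon-coefficients : ∀ {n} (f : Vec Bool n → ℤ) {B : Vec Bool n → Set} → (∀ x → f x * f x ≡ 1ℤ) →
    (∀ S → fourier f S ≢ 0ℤ → B S) → Sidon B → ∀ {a b} → a ≢ b → fourier f a * fourier f b ≡ 0ℤ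
  sidon-coefficients {n} f {B} f²≡1 support sidon {a} {b} a≢b with fourier f a * fourier f b ≟ 0ℤ
  ... | yes q≡0 = q≡0
  -- Multiplying the vanishing sum by `q` makes its terms nonnegative: they are the square of `q` at
  -- `a` and `b`, and zero elsewhere by the Sidon property. Hence the square of `q` is zero.
  ... | no  q≢0 = square≡0 (trans (cong (q *_) (sym term-a))
    (∑-nonneg-≤0 (cube n) {λ T → q * term T} (λ {T} _ → nonneg T) (≤-reflexive total) (∈-cube a)))
    where
    q = fourier f a * fourier f b
    term : Vec Bool n → ℤ
    term T = fourier f T * fourier f (T ⊕ (a ⊕ b))
    Ba : B a
    Ba = support a (λ eq → q≢0 (trans (cong (_* fourier f b) eq) (*-zeroˡ (fourier f b))))
    Bb : B b
    Bb = support b (λ eq → q≢0 (trans (cong (fourier f a *_) eq) (*-zeroʳ (fourier f a))))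
    term-a : term a ≡ q
    term-a = cong (λ S → fourier f a * fourier f S) (⊕-cancelˡ a b)
    term-b : term b ≡ q
    term-b = trans (cong (λ S → fourier f b * fourier f S)
      (trans (cong (b ⊕_) (⊕-comm a b)) (⊕-cancelˡ b a)))
                   (*-comm (fourier f b) (fourier f a))
    nonneg : ∀ T → 0ℤ ≤ q * term T
    nonneg T with T ≟ᵛ a | T ≟ᵛ b | term T ≟ 0ℤ
    ... | yes refl | _        | _      = subst (λ t → 0ℤ ≤ q * t) (sym term-a) (square-nonneg q)
    ... | no _     | yes refl | _      = subst (λ t → 0ℤ ≤ q * t) (sym term-b) (square-nonneg q)
    ... | no _     | no _     | yes t≡0 = ≤-reflexive (sym (trans (cong (q *_) t≡0) (*-zeroʳ q)))
    ... | no T≢a   | no T≢b   | no t≢0 = contradiction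
      (support (T ⊕ (a ⊕ b)) (λ eq → t≢0 (trans (cong (fourier f T *_) eq) (*-zeroʳ (fourier f T)))))
      (sidon Ba Bb (support T (λ eq → t≢0
        (trans (cong (_* fourier f (T ⊕ (a ⊕ b))) eq) (*-zeroˡ (fourier f (T ⊕ (a ⊕ b))))))) a≢b T≢a T≢b)
    total : ∑ (cube n) (λ T → q * term T) ≡ 0ℤ
    total = begin
      ∑ (cube n) (λ T → q * term T)
        ≡⟨ ∑-*ˡ (cube n) q term ⟩
      q * ∑ (cube n) term
        ≡⟨ cong (q *_) (∑-cong (cube n) (λ T → cong (fourier f T *_) (sym (fourier-*χ f (a ⊕ b) T)))) ⟩
      q * ∑ (cube n) (λ T → fourier f T * fourier (λ x → f x * χ (a ⊕ b) x) T)
        ≡⟨ cong (q *_) (plancherel f (λ x → f x * χ (a ⊕ b) x)) ⟩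
      q * ((+ 2) ^ n * ∑ (cube n) (λ x → f x * (f x * χ (a ⊕ b) x)))
        ≡⟨ cong (λ t → q * ((+ 2) ^ n * t))
          (∑-cong (cube n) (λ x → trans (sym (*-assoc (f x) (f x) _))
          (trans (cong (_* χ (a ⊕ b) x) (f²≡1 x)) (*-identityˡ (χ (a ⊕ b) x))))) ⟩
      q * ((+ 2) ^ n * ∑ (cube n) (χ (a ⊕ b)))
        ≡⟨ cong (λ t → q * ((+ 2) ^ n * t)) (∑-χ (a ⊕ b) (λ a⊕b≡𝟎 → a≢b (⊕≡𝟎⇒≡ a b a⊕b≡𝟎))) ⟩
      q * ((+ 2) ^ n * 0ℤ)
        ≡⟨ cong (q *_) (*-zeroʳ ((+ 2) ^ n)) ⟩
      q * 0ℤ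
        ≡⟨ *-zeroʳ q ⟩
      0ℤ ∎
      where open ≡-Reasoning

  2^n-pos : ∀ n → 0ℤ < (+ 2) ^ n
  2^n-pos zero    = +<+ (s≤s z≤n)
  2^n-pos (suc n) = *-monoˡ-<-pos (+ 2) (2^n-pos n)

  2^n≢0 : ∀ n → (+ 2) ^ n ≢ 0ℤ
  2^n≢0 n eq = <⇒≢ (2^n-pos n) (sym eq)

  -- Some coefficient, at `a` say, is nonzero because `f` is; `sidon-coefficients` then kills all
  -- others. Comparing inversion at `x` and at `𝟎` gives `f` as `f 𝟎` times `χ a`.
  sidon-character : ∀ {n} (f : Vec Bool n → ℤ) {B : Vec Bool n → Set} → (∀ x → f x * f x ≡ 1ℤ) →
    (∀ S → fourier f S ≢ 0ℤ → B S) → Sidon B → ∃[ a ] B a × (∀ x → f x * χ a x ≡ f 𝟎)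
  sidon-character {n} f {B} f²≡1 support sidon with ∑≢0⇒∃≢0 (cube n) {λ S → fourier f S * χ S 𝟎} nonzero
    where
    f𝟎≢0 : f 𝟎 ≢ 0ℤ
    f𝟎≢0 f𝟎≡0 with () ← trans (sym (f²≡1 𝟎)) (cong₂ _*_ f𝟎≡0 f𝟎≡0)
    nonzero : ∑ (cube n) (λ S → fourier f S * χ S 𝟎) ≢ 0ℤ
    nonzero eq with i*j≡0⇒i≡0∨j≡0 ((+ 2) ^ n) (trans (sym (fourier-inversion f 𝟎)) eq)
    ... | inj₁ 2^n≡0 = 2^n≢0 n 2^n≡0
    ... | inj₂ f𝟎≡0  = f𝟎≢0 f𝟎≡0
  ... | a , a-term≢0 = a , support a f̂a≢0 , constant
    where
    f̂a≢0 : fourier f a ≢ 0ℤ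
    f̂a≢0 eq = a-term≢0 (trans (cong (_* χ a 𝟎) eq) (*-zeroˡ (χ a 𝟎)))
    vanish : ∀ x S → fourier f S * χ S x * χ a x - fourier f S * χ S 𝟎 ≡ 0ℤ
    vanish x S with a ≟ᵛ S
    ... | yes refl = trans (cong₂ _-_
      (trans (*-assoc (fourier f a) _ _) (cong (fourier f a *_) (χ-square a x)))
      (cong (fourier f a *_) (χ-𝟎ʳ a))) (+-inverseʳ (fourier f a * 1ℤ))
    ... | no a≢S with i*j≡0⇒i≡0∨j≡0 (fourier f a) (sidon-coefficients f f²≡1 support sidon a≢S)
    ...   | inj₁ f̂a≡0 = contradiction f̂a≡0 f̂a≢0
    ...   | inj₂ f̂S≡0 = cong₂ (λ s t → s * χ S x * χ a x - t * χ S 𝟎) f̂S≡0 f̂S≡0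
    constant : ∀ x → f x * χ a x ≡ f 𝟎
    constant x = *-cancelˡ-≡ ((+ 2) ^ n) _ _ {{≢-nonZero (2^n≢0 n)}} (i-j≡0⇒i≡j _ _ (begin
      (+ 2) ^ n * (f x * χ a x) - (+ 2) ^ n * f 𝟎
        ≡⟨ cong₂ _-_ (trans (sym (*-assoc ((+ 2) ^ n) (f x) (χ a x)))
          (cong (_* χ a x) (sym (fourier-inversion f x)))) (sym (fourier-inversion f 𝟎)) ⟩
      ∑ (cube n) (λ S → fourier f S * χ S x) * χ a x - ∑ (cube n) (λ S → fourier f S * χ S 𝟎)
        ≡⟨ cong (_- _) (∑-*ʳ (cube n) (χ a x) (λ S → fourier f S * χ S x)) ⟨
      ∑ (cube n) (λ S → fourier f S * χ S x * χ a x) - ∑ (cube n) (λ S → fourier f S * χ S 𝟎)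
        ≡⟨ ∑-- (cube n) (λ S → fourier f S * χ S x * χ a x) (λ S → fourier f S * χ S 𝟎) ⟨
      ∑ (cube n) (λ S → fourier f S * χ S x * χ a x - fourier f S * χ S 𝟎)
        ≡⟨ ∑-zero (cube n) (vanish x) ⟩
      0ℤ ∎))
      where open ≡-Reasoning

  module Xor =
    CommutativeSemigroupProperties (CommutativeRing.+-commutativeSemigroup Bool.xor-∧-commutativeRing)

  -- Weights

  zeros : ∀ {n} → Vec Bool n → ℕ
  zeros []          = 0
  zeros (true  ∷ x) = zeros x
  zeros (false ∷ x) = suc (zeros x)

  weight+zeros : ∀ {n} (x : Vec Bool n) → weight x ℕ.+ zeros x ≡ n
  weight+zeros []          = refl
  weight+zeros (true  ∷ x) = cong suc (weight+zeros x)
  weight+zeros (false ∷ x) = trans (ℕ.+-suc (weight x) (zeros x)) (cong suc (weight+zeros x))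

  weight-𝟎 : ∀ n → weight (𝟎 {n}) ≡ 0
  weight-𝟎 zero    = refl
  weight-𝟎 (suc n) = weight-𝟎 n

  weight≡0⇒≡𝟎 : ∀ {n} (x : Vec Bool n) → weight x ≡ 0 → x ≡ 𝟎
  weight≡0⇒≡𝟎 []          _   = refl
  weight≡0⇒≡𝟎 (false ∷ x) w≡0 = cong (false ∷_) (weight≡0⇒≡𝟎 x w≡0)

  𝟏 : ∀ {n} → Vec Bool n
  𝟏 = replicate _ true

  zeros≡0⇒≡𝟏 : ∀ {n} (x : Vec Bool n) → zeros x ≡ 0 → x ≡ 𝟏
  zeros≡0⇒≡𝟏 []         _   = refl
  zeros≡0⇒≡𝟏 (true ∷ x) z≡0 = cong (true ∷_) (zeros≡0⇒≡𝟏 x z≡0)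

  zeros-𝟏⊕ : ∀ {n} (x : Vec Bool n) → zeros (𝟏 ⊕ x) ≡ weight x
  zeros-𝟏⊕ []          = refl
  zeros-𝟏⊕ (true  ∷ x) = cong suc (zeros-𝟏⊕ x)
  zeros-𝟏⊕ (false ∷ x) = zeros-𝟏⊕ x

  ⊕-identityˡ : ∀ {n} (x : Vec Bool n) → 𝟎 ⊕ x ≡ x
  ⊕-identityˡ x = trans (⊕-comm 𝟎 x) (⊕-identityʳ x)

  ⊕-leftComm : ∀ {n} (x y z : Vec Bool n) → x ⊕ (y ⊕ z) ≡ y ⊕ (x ⊕ z)
  ⊕-leftComm []      []      []      = refl
  ⊕-leftComm (b ∷ x) (c ∷ y) (d ∷ z) = cong₂ _∷_
    (Xor.x∙yz≈y∙xz b c d)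
    (⊕-leftComm x y z)

  lookup-ext-𝟎 : ∀ {n} (x : Vec Bool n) → (∀ i → lookup x i ≡ false) → x ≡ 𝟎
  lookup-ext-𝟎 []      _ = refl
  lookup-ext-𝟎 (b ∷ x) h = cong₂ _∷_ (h zero) (lookup-ext-𝟎 x (h ∘ suc))

  unit : ∀ {n} → Fin n → Vec Bool n
  unit zero    = true ∷ 𝟎
  unit (suc i) = false ∷ unit i

  weight≡1⇒unit : ∀ {n} (x : Vec Bool n) → weight x ≡ 1 → ∃[ i ] x ≡ unit i
  weight≡1⇒unit (true  ∷ x) w≡1 = zero , cong (true ∷_) (weight≡0⇒≡𝟎 x (ℕ.suc-injective w≡1))
  weight≡1⇒unit (false ∷ x) w≡1 with i , x≡unit ← weight≡1⇒unit x w≡1 = suc i , cong (false ∷_) x≡unit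

  lookup-unit-same : ∀ {n} (i : Fin n) → lookup (unit i) i ≡ true
  lookup-unit-same zero    = refl
  lookup-unit-same (suc i) = lookup-unit-same i

  lookup-unit-other : ∀ {n} {i j : Fin n} → i ≢ j → lookup (unit i) j ≡ false
  lookup-unit-other {i = zero}  {zero}  i≢j = contradiction refl i≢j
  lookup-unit-other {i = zero}  {suc j} i≢j = lookup-replicate j false
  lookup-unit-other {i = suc i} {zero}  i≢j = refl
  lookup-unit-other {i = suc i} {suc j} i≢j = lookup-unit-other (i≢j ∘ cong suc)

  weight-unit⊕-set : ∀ {n} (i : Fin n) x → lookup x i ≡ false → weight (unit i ⊕ x) ≡ suc (weight x)
  weight-unit⊕-set zero    (false ∷ x) _  = cong suc (cong weight (⊕-identityˡ x))
  weight-unit⊕-set (suc i) (true  ∷ x) eq = cong suc (weight-unit⊕-set i x eq)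
  weight-unit⊕-set (suc i) (false ∷ x) eq = weight-unit⊕-set i x eq

  weight-unit⊕-clear : ∀ {n} (i : Fin n) x → lookup x i ≡ true → suc (weight (unit i ⊕ x)) ≡ weight x
  weight-unit⊕-clear zero    (true  ∷ x) _  = cong suc (cong weight (⊕-identityˡ x))
  weight-unit⊕-clear (suc i) (true  ∷ x) eq = cong suc (weight-unit⊕-clear i x eq)
  weight-unit⊕-clear (suc i) (false ∷ x) eq = weight-unit⊕-clear i x eq

  weight-unit : ∀ {n} (i : Fin n) → weight (unit i) ≡ 1
  weight-unit {suc n} zero    = cong suc (weight-𝟎 n)
  weight-unit         (suc i) = weight-unit i

  weight-exists : ∀ {n} m → m ℕ.≤ n → ∃[ x ] weight {n} x ≡ m
  weight-exists {n}     zero    _         = 𝟎 , weight-𝟎 n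
  weight-exists {suc n} (suc m) (s≤s m≤n) with x , w≡m ← weight-exists m m≤n = true ∷ x , cong suc w≡m

  weight-exists-at : ∀ {n} (i : Fin n) m → suc m ℕ.≤ n → ∃[ x ] lookup x i ≡ true × weight {n} x ≡ suc m
  weight-exists-at zero    m (s≤s m≤n) with x , w≡m ← weight-exists m m≤n = true ∷ x , refl , cong suc w≡m
  weight-exists-at (suc i) zero    _ = false ∷ unit i , lookup-unit-same i , weight-unit i
  weight-exists-at (suc i) (suc m) (s≤s m<n) with x , at , w≡ ← weight-exists-at i m m<n =
    true ∷ x , at , cong suc w≡

  -- The unit vectors and `𝟏`: the indices of the characters that read off the coordinates of
  -- `evenLift x`, with `𝟏` giving the parity bit.
  Extremal : ∀ {n} → Vec Bool n → Set
  Extremal S = weight S ≡ 1 ⊎ zeros S ≡ 0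

  ¬extremal : ∀ {n} (S : Vec Bool n) → 2 ℕ.≤ weight S → 1 ℕ.≤ zeros S → ¬ Extremal S
  ¬extremal S 2≤w 1≤z (inj₁ w≡1) = contradiction (subst (2 ℕ.≤_) w≡1 2≤w) (λ { (s≤s ()) })
  ¬extremal S 2≤w 1≤z (inj₂ z≡0) = contradiction (subst (1 ℕ.≤_) z≡0 1≤z) (λ ())

  weight-unit⊕unit : ∀ {n} {i j : Fin n} → unit i ≢ unit j → weight (unit i ⊕ unit j) ≡ 2
  weight-unit⊕unit {i = i} {j} i≢j =
    trans (weight-unit⊕-set i (unit j) (lookup-unit-other (λ j≡i → i≢j (cong unit (sym j≡i)))))
      (cong suc (weight-unit j))

  UnitOr𝟏 : ∀ {n} → Vec Bool n → Set
  UnitOr𝟏 S = (∃[ i ] S ≡ unit i) ⊎ S ≡ 𝟏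

  extremal-shape : ∀ {n} (S : Vec Bool n) → Extremal S → UnitOr𝟏 S
  extremal-shape S (inj₁ w≡1) = inj₁ (weight≡1⇒unit S w≡1)
  extremal-shape S (inj₂ z≡0) = inj₂ (zeros≡0⇒≡𝟏 S z≡0)

  -- Three distinct unit vectors sum to a vector of weight 3, and `𝟏` with two distinct unit vectors
  -- to one with exactly two zeros. For `n` at least 4 neither is a unit vector or `𝟏`.
  extremal-sidon : ∀ {n} → 4 ℕ.≤ n → Sidon (Extremal {n})
  extremal-sidon {n} 4≤n Ba Bb Bc =
    cases (extremal-shape _ Ba) (extremal-shape _ Bb) (extremal-shape _ Bc)
    where
    one-𝟏 : ∀ {i j} → unit i ≢ unit j → ¬ Extremal (𝟏 ⊕ (unit i ⊕ unit j))
    one-𝟏 {i} {j} i≢j = ¬extremal S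
      (ℕ.+-cancelʳ-≤ 2 2 _ (subst (4 ℕ.≤_)
        (sym (trans (cong (weight S ℕ.+_) (sym zeros≡2)) (weight+zeros S))) 4≤n))
      (subst (1 ℕ.≤_) (sym zeros≡2) (s≤s z≤n))
      where
      S = 𝟏 ⊕ (unit i ⊕ unit j)
      zeros≡2 : zeros S ≡ 2
      zeros≡2 = trans (zeros-𝟏⊕ (unit i ⊕ unit j)) (weight-unit⊕unit i≢j)
    cases : ∀ {a b c} → UnitOr𝟏 a → UnitOr𝟏 b → UnitOr𝟏 c → a ≢ b → c ≢ a → c ≢ b → ¬ Extremal
      (c ⊕ (a ⊕ b))
    cases (inj₂ refl) (inj₂ refl) _ a≢b _ _ = contradiction refl a≢b
    cases (inj₂ refl) _ (inj₂ refl) _ c≢a _ = contradiction refl c≢a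
    cases _ (inj₂ refl) (inj₂ refl) _ _ c≢b = contradiction refl c≢b
    cases (inj₁ (i , refl)) (inj₁ (j , refl)) (inj₂ refl) a≢b c≢a c≢b = one-𝟏 a≢b
    cases (inj₂ refl) (inj₁ (j , refl)) (inj₁ (l , refl)) a≢b c≢a c≢b =
      subst (¬_ ∘ Extremal) (⊕-leftComm 𝟏 (unit l) (unit j)) (one-𝟏 c≢b)
    cases (inj₁ (i , refl)) (inj₂ refl) (inj₁ (l , refl)) a≢b c≢a c≢b =
      subst (¬_ ∘ Extremal) (trans (⊕-leftComm 𝟏 (unit l) (unit i))
        (cong (unit l ⊕_) (⊕-comm 𝟏 (unit i)))) (one-𝟏 c≢a)
    cases (inj₁ (i , refl)) (inj₁ (j , refl)) (inj₁ (l , refl)) a≢b c≢a c≢b = ¬extremal S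
      (subst (2 ℕ.≤_) (sym weight≡3) (s≤s (s≤s z≤n)))
      (ℕ.+-cancelˡ-≤ 3 1 _ (subst (4 ℕ.≤_)
        (sym (trans (cong (ℕ._+ zeros S) (sym weight≡3)) (weight+zeros S))) 4≤n))
      where
      S = unit l ⊕ (unit i ⊕ unit j)
      weight≡3 : weight S ≡ 3
      weight≡3 = trans
        (weight-unit⊕-set l (unit i ⊕ unit j) (trans (lookup-zipWith _xor_ l (unit i) (unit j))
          (cong₂ _xor_ (lookup-unit-other (λ i≡l → c≢a (cong unit (sym i≡l))))
            (lookup-unit-other (λ j≡l → c≢b (cong unit (sym j≡l)))))))
        (cong suc (weight-unit⊕unit a≢b))

  -- Parity bits

  odd : ∀ {n} → Vec Bool n → Bool
  odd []      = false
  odd (b ∷ x) = b xor odd x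

  parity-weight : ∀ {n} (x : Vec Bool n) → parity (weight x) ≡ sgn (odd x)
  parity-weight []          = refl
  parity-weight (false ∷ x) = parity-weight x
  parity-weight (true  ∷ x) = trans (cong -_ (parity-weight x)) (neg-sgn (odd x))
    where
    neg-sgn : ∀ b → - sgn b ≡ sgn (true xor b)
    neg-sgn true  = refl
    neg-sgn false = refl

  odd-⊕ : ∀ {n} (x y : Vec Bool n) → odd (x ⊕ y) ≡ odd x xor odd y
  odd-⊕ []          []      = refl
  odd-⊕ (b ∷ x) (c ∷ y) =
    trans (cong ((b xor c) xor_) (odd-⊕ x y)) (Xor.interchange b c (odd x) (odd y))

  -- An additive bijection onto the vectors of even weight.
  evenLift : ∀ {n} → Vec Bool n → Vec Bool (suc n)
  evenLift x = odd x ∷ x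

  evenLift-⊕ : ∀ {n} (x y : Vec Bool n) → evenLift x ⊕ evenLift y ≡ evenLift (x ⊕ y)
  evenLift-⊕ x y = cong (_∷ x ⊕ y) (sym (odd-⊕ x y))

  weight-∷ : ∀ {n} b (x : Vec Bool n) → weight x ℕ.≤ weight (b ∷ x)
  weight-∷ true  x = ℕ.n≤1+n _
  weight-∷ false x = ℕ.≤-refl

  -- A vector of weight exactly `k` is odd and receives the parity bit 1; a heavier one is already
  -- heavy enough.
  weight-evenLift : ∀ {n k} (x : Vec Bool n) → parity k ≡ -1ℤ → k ℕ.≤ weight x → suc k ℕ.≤ weight
    (evenLift x)
  weight-evenLift x k-odd k≤w with ℕ.m≤n⇒m<n∨m≡n k≤w
  ... | inj₁ k<w  = ℕ.≤-trans k<w (weight-∷ (odd x) x)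
  ... | inj₂ refl with odd x | trans (sym (parity-weight x)) k-odd
  ...   | true | _ = ℕ.≤-refl

  -- Fourier transforms of weight layers

  layer : ∀ {n} → ℕ → Vec Bool n → ℤ
  layer K x = if weight x ≡ᵇ K then 1ℤ else 0ℤ

  layer-≡ : ∀ {n K} (x : Vec Bool n) → weight x ≡ K → layer K x ≡ 1ℤ
  layer-≡ x refl = cong (if_then 1ℤ else 0ℤ) (≡ᵇ-refl (weight x))
    where
    ≡ᵇ-refl : ∀ m → (m ≡ᵇ m) ≡ true
    ≡ᵇ-refl zero    = refl
    ≡ᵇ-refl (suc m) = ≡ᵇ-refl m

  layer-nonneg : ∀ {n} K (x : Vec Bool n) → 0ℤ ≤ layer K x
  layer-nonneg K x with weight x ≡ᵇ K
  ... | true  = +≤+ z≤n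
  ... | false = ≤-refl

  layer-*-mono : ∀ {n} K (x : Vec Bool n) {a b} → (weight x ≡ K → a ≤ b) → layer K x * a ≤ layer K x * b
  layer-*-mono K x {a} {b} a≤b with weight x ≡ᵇ K | ℕ.≡ᵇ⇒≡ (weight x) K
  ... | true  | w≡K = *-monoˡ-≤-nonNeg 1ℤ (a≤b (w≡K _))
  ... | false | _   = ≤-reflexive (trans (*-zeroˡ a) (sym (*-zeroˡ b)))

  -- Summing t^(weight x) times `χ S x` over the cube factors over coordinates: each contributes
  -- `1 - t` where `S` is true and `1 + t` where it is false.
  fourier-layer : ∀ {n} K (S : Vec Bool n) → fourier (layer K) S ≡ kraw (weight S) (zeros S) K
  fourier-layer zero    []      = refl
  fourier-layer (suc K) []      = refl
  fourier-layer {suc n} zero    (s ∷ S) = begin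
    fourier (layer 0) (s ∷ S)                                    ≡⟨ fourier-∷ (layer 0) s S ⟩
    fourier (layer 0) S + sgn s * ∑ (cube n) (λ x → 0ℤ * χ S x)
      ≡⟨ cong₂ (λ t u → t + sgn s * u) (fourier-layer 0 S) (∑-zero (cube n) (λ x → *-zeroˡ (χ S x))) ⟩
    kraw (weight S) (zeros S) 0 + sgn s * 0ℤ
      ≡⟨ cong (_+_ (kraw (weight S) (zeros S) 0)) (*-zeroʳ (sgn s)) ⟩
    kraw (weight S) (zeros S) 0 + 0ℤ                             ≡⟨⟩
    1ℤ                                                           ≡⟨⟩
    kraw (weight (s ∷ S)) (zeros (s ∷ S)) 0                      ∎
    where open ≡-Reasoning
  fourier-layer (suc K) (false ∷ S) = begin
    fourier (layer (suc K)) (false ∷ S)                          ≡⟨ fourier-∷ (layer (suc K)) false S ⟩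
    fourier (layer (suc K)) S + 1ℤ * fourier (layer K) S
      ≡⟨ cong₂ (λ t u → t + 1ℤ * u) (fourier-layer (suc K) S) (fourier-layer K S) ⟩
    kraw (weight S) (zeros S) (suc K) + 1ℤ * kraw (weight S) (zeros S) K
      ≡⟨ cong (_+_ (kraw (weight S) (zeros S) (suc K))) (*-identityˡ (kraw (weight S) (zeros S) K)) ⟩
    kraw (weight S) (zeros S) (suc K) + kraw (weight S) (zeros S) K
      ≡⟨ kraw-suc (weight S) (zeros S) K ⟨
    kraw (weight S) (suc (zeros S)) (suc K)                      ∎
    where open ≡-Reasoning
  fourier-layer (suc K) (true ∷ S) = begin
    fourier (layer (suc K)) (true ∷ S)                           ≡⟨ fourier-∷ (layer (suc K)) true S ⟩
    fourier (layer (suc K)) S + -1ℤ * fourier (layer K) S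
      ≡⟨ cong₂ (λ t u → t + -1ℤ * u) (fourier-layer (suc K) S) (fourier-layer K S) ⟩
    kraw (weight S) (zeros S) (suc K) + -1ℤ * kraw (weight S) (zeros S) K
      ≡⟨ cong (_+_ (kraw (weight S) (zeros S) (suc K))) (-1*i≡-i (kraw (weight S) (zeros S) K)) ⟩
    kraw (suc (weight S)) (zeros S) (suc K)                      ∎
    where open ≡-Reasoning

  -- Abstract, since unfolding sums over a nonempty list of coordinates makes conversion explode.
  abstract
    coordinates : ∀ n → List (Fin n)
    coordinates = allFin

    ∈-coordinates : ∀ {n} (i : Fin n) → i ∈ coordinates n
    ∈-coordinates = ∈-allFin

    length-coordinates : ∀ n → length (coordinates n) ≡ n
    length-coordinates n = length-tabulate {n = n} id

    ∑-coordinates-suc : ∀ {n} (f : Fin (suc n) → ℤ) →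
                        ∑ (coordinates (suc n)) f ≡ f zero + ∑ (coordinates n) (f ∘ suc)
    ∑-coordinates-suc {n} f = cong (_+_ (f zero))
      (trans (cong (λ is → ∑ is f) (sym (map-tabulate id suc))) (∑-map suc (allFin n) f))

    ∑-coordinates-zero : (f : Fin 0 → ℤ) → ∑ (coordinates 0) f ≡ 0ℤ
    ∑-coordinates-zero f = refl

  ∑-sgn-lookup : ∀ {n} (x : Vec Bool n) → ∑ (coordinates n) (λ i → sgn (lookup x i)) ≡ + n -
    (+ weight x + + weight x)
  ∑-sgn-lookup [] = ∑-coordinates-zero _
  ∑-sgn-lookup {suc n} (b ∷ x) = trans (∑-coordinates-suc (λ i → sgn (lookup (b ∷ x) i)))
    (trans (cong (_+_ (sgn b)) (∑-sgn-lookup x)) (step b))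
    where
    step₀ : ∀ m w → 1ℤ + (m - w) ≡ 1ℤ + m - w
    step₀ = solve-∀
    step₁ : ∀ m w → -1ℤ + (m - (w + w)) ≡ 1ℤ + m - (1ℤ + w + (1ℤ + w))
    step₁ = solve-∀
    step : ∀ b → sgn b + (+ n - (+ weight x + + weight x)) ≡ + suc n -
      (+ weight (b ∷ x) + + weight (b ∷ x))
    step false = step₀ (+ n) (+ weight x + + weight x)
    step true  = step₁ (+ n) (+ weight x)

  sgn-lookup-⊕ : ∀ {n} (x y : Vec Bool n) i → sgn (lookup x i) * sgn (lookup y i) ≡ sgn (lookup (x ⊕ y) i)
  sgn-lookup-⊕ x y i = trans (sym (sgn-xor (lookup x i) (lookup y i)))
    (cong sgn (sym (lookup-zipWith _xor_ i x y)))

  χ-𝟎ˡ : ∀ {n} (x : Vec Bool n) → χ 𝟎 x ≡ 1ℤ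
  χ-𝟎ˡ x = trans (χ-sym 𝟎 x) (χ-𝟎ʳ x)

  χ-unit : ∀ {n} (i : Fin n) x → χ (unit i) x ≡ sgn (lookup x i)
  χ-unit zero    (b ∷ x) = trans (cong (sgn b *_) (χ-𝟎ˡ x)) (*-identityʳ (sgn b))
  χ-unit (suc i) (b ∷ x) = trans (*-identityˡ (χ (unit i) x)) (χ-unit i x)

  χ-𝟏 : ∀ {n} (x : Vec Bool n) → χ 𝟏 x ≡ sgn (odd x)
  χ-𝟏 []      = refl
  χ-𝟏 (b ∷ x) = trans (cong (sgn b *_) (χ-𝟏 x)) (sym (sgn-xor b (odd x)))

  -- Endomorphisms of Q_{n/k} for odd k

  -- Here `a` and `z` stand for the weight and the zeros of an index. At `a` zero a positive
  -- binomial coefficient meets a nonpositive number; the remaining interior case is `kraw-strict`.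
  kraw-dichotomy : ∀ {n} K a z → a ℕ.+ z ≡ n → K ℕ.≤ n → 3 ℕ.+ n ℕ.≤ K ℕ.+ K →
                   (a ≡ 1 ⊎ z ≡ 0) ⊎ kraw 1 n K < kraw a (suc z) K
  kraw-dichotomy K zero z refl K≤n p =
    inj₂ (≤-<-trans (kraw-1-nonpos z K (ℕ.<⇒≤ p)) (kraw-0-pos (suc z) K (ℕ.m≤n⇒m≤1+n K≤n)))
  kraw-dichotomy K (suc zero) z _ _ _ = inj₁ (inj₁ refl)
  kraw-dichotomy K (suc (suc a)) zero _ _ _ = inj₁ (inj₂ refl)
  kraw-dichotomy K (suc (suc a)) (suc z) refl K≤n p =
    inj₂ (subst (λ m → kraw 1 (2 ℕ.+ m) K < kraw (2 ℕ.+ a) (2 ℕ.+ z) K) (sym (ℕ.+-suc a z))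
    (kraw-strict a z K (subst (λ m → K ℕ.≤ 2 ℕ.+ m) (ℕ.+-suc a z) K≤n)
      (subst (λ m → 5 ℕ.+ m ℕ.≤ K ℕ.+ K) (ℕ.+-suc a z) p)))

  kraw-1-minimal : ∀ {n} K a z → a ℕ.+ z ≡ n → 3 ℕ.+ n ℕ.≤ K ℕ.+ K → kraw 1 n K ≤ kraw a (suc z) K
  kraw-1-minimal K zero    z refl p = ≤-trans (kraw-1-nonpos z K (ℕ.<⇒≤ p)) (kraw-0-nonneg (suc z) K)
  kraw-1-minimal K (suc a) z refl p = proj₁ (kraw-bound a z K (ℕ.<⇒≤ p))

  gap-square≡0 : ∀ c u v → c < u → (u - c) * (v * v) ≡ 0ℤ → v ≡ 0ℤ
  gap-square≡0 c u v c<u eq with i*j≡0⇒i≡0∨j≡0 (u - c) eq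
  ... | inj₁ u-c≡0 = contradiction (sym (i-j≡0⇒i≡j u c u-c≡0)) (<⇒≢ c<u)
  ... | inj₂ v²≡0  = square≡0 v²≡0

  -- Taking products removes the unknown sign `c`.
  character-product : ∀ {n} (f : Vec Bool n → ℤ) b {c} → c * c ≡ 1ℤ → (∀ x → f x * χ b x ≡ c) →
                      ∀ x y → f x * f y ≡ χ b (x ⊕ y)
  character-product f b {c} c²≡1 f-χ x y = begin
    f x * f y                                ≡⟨ *-identityʳ (f x * f y) ⟨
    f x * f y * 1ℤ                           ≡⟨ cong (f x * f y *_) (χ-square b (x ⊕ y)) ⟨
    f x * f y * (χ b (x ⊕ y) * χ b (x ⊕ y))  ≡⟨ *-assoc (f x * f y) (χ b (x ⊕ y)) (χ b (x ⊕ y)) ⟨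
    f x * f y * χ b (x ⊕ y) * χ b (x ⊕ y)    ≡⟨ cong (_* χ b (x ⊕ y)) product≡1 ⟩
    1ℤ * χ b (x ⊕ y)                         ≡⟨ *-identityˡ (χ b (x ⊕ y)) ⟩
    χ b (x ⊕ y)                              ∎
    where
    open ≡-Reasoning
    product≡1 : f x * f y * χ b (x ⊕ y) ≡ 1ℤ
    product≡1 = begin
      f x * f y * χ b (x ⊕ y)      ≡⟨ cong (f x * f y *_) (χ-⊕ʳ b x y) ⟩
      f x * f y * (χ b x * χ b y)  ≡⟨ *-interchange (f x) (f y) (χ b x) (χ b y) ⟩
      f x * χ b x * (f y * χ b y)  ≡⟨ cong₂ _*_ (f-χ x) (f-χ y) ⟩
      c * c                        ≡⟨ c²≡1 ⟩
      1ℤ                           ∎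

  -- Plancherel for `f` against its convolution with `w` minus `c` times `f`: the quadratic form is
  -- diagonal in the characters.
  fourier-energy : ∀ {n} (w f : Vec Bool n → ℤ) c →
    ∑ (cube n) (λ S → (fourier w S - c) * (fourier f S * fourier f S))
      ≡ (+ 2) ^ n * ∑ (cube n) (λ x → f x * (convolve w f x - c * f x))
  fourier-energy {n} w f c = trans (∑-cong (cube n) pointwise)
    (plancherel f (λ x → convolve w f x - c * f x))
    where
    open ≡-Reasoning
    factor : ∀ u v c → (u - c) * (v * v) ≡ v * (u * v - c * v)
    factor = solve-∀
    expand : ∀ u v c s → (u - c * v) * s ≡ u * s - c * (v * s)
    expand = solve-∀
    pointwise : ∀ S → (fourier w S - c) * (fourier f S * fourier f S)
                    ≡ fourier f S * fourier (λ x → convolve w f x - c * f x) S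
    pointwise S = begin
      (fourier w S - c) * (fourier f S * fourier f S)
        ≡⟨ factor (fourier w S) (fourier f S) c ⟩
      fourier f S * (fourier w S * fourier f S - c * fourier f S)
        ≡⟨ cong₂ (λ s t → fourier f S * (s - t)) (sym (fourier-convolve w f S))
          (sym (∑-*ˡ (cube n) c (λ x → f x * χ S x))) ⟩
      fourier f S * (fourier (convolve w f) S - ∑ (cube n) (λ x → c * (f x * χ S x)))
        ≡⟨ cong (fourier f S *_) (∑-- (cube n) (λ x → convolve w f x * χ S x) (λ x → c * (f x * χ S x))) ⟨
      fourier f S * ∑ (cube n) (λ x → convolve w f x * χ S x - c * (f x * χ S x))
        ≡⟨ cong (fourier f S *_) (∑-cong (cube n) (λ x → expand (convolve w f x) (f x) c (χ S x))) ⟨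
      fourier f S * fourier (λ x → convolve w f x - c * f x) S ∎

  module Endomorphism {n k : ℕ} (k-odd : parity k ≡ -1ℤ) (k<n : k ℕ.< n) (n<2k : n ℕ.< k ℕ.+ k)
    (φ : Vec Bool n → Vec Bool n)
    (φ-hom : ∀ {x y} → k ℕ.≤ weight (x ⊕ y) → k ℕ.≤ weight (φ x ⊕ φ y)) where

    -- An odd `k` is at least 3 here, since `k` equal to 1 leaves no room for `n` between 1 and 2.
    4≤n : 4 ℕ.≤ n
    4≤n = bound k k-odd k<n n<2k
      where
      bound : ∀ k → parity k ≡ -1ℤ → k ℕ.< n → n ℕ.< k ℕ.+ k → 4 ℕ.≤ n
      bound 1 _ 1<n (s≤s n≤1) = contradiction n≤1 (ℕ.<⇒≱ 1<n)
      bound (suc (suc (suc k))) _ k<n _ = ℕ.≤-trans (s≤s (s≤s (s≤s (s≤s z≤n)))) k<n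

    3+n≤2K : 3 ℕ.+ n ℕ.≤ suc k ℕ.+ suc k
    3+n≤2K = ℕ.≤-trans (s≤s (s≤s n<2k)) (ℕ.≤-reflexive (cong suc (sym (ℕ.+-suc k k))))

    -- The indicator of the z whose even lift has weight k + 1.
    w : Vec Bool n → ℤ
    w z = layer (suc k) z + layer k z

    -- `λ₁` is the eigenvalue at unit vectors; `D` is the inner product of two sign vectors of
    -- length `suc n` that differ in `suc k` places.
    λ₁ D : ℤ
    λ₁ = kraw 1 n (suc k)
    D  = + suc n - (+ suc k + + suc k)

    fourier-w : ∀ S → fourier w S ≡ kraw (weight S) (suc (zeros S)) (suc k)
    fourier-w S = begin
      fourier w S
        ≡⟨ ∑-cong (cube n) (λ z → *-distribʳ-+ (χ S z) (layer (suc k) z) (layer k z)) ⟩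
      ∑ (cube n) (λ z → layer (suc k) z * χ S z + layer k z * χ S z)
        ≡⟨ ∑-+ (cube n) (λ z → layer (suc k) z * χ S z) (λ z → layer k z * χ S z) ⟩
      fourier (layer (suc k)) S + fourier (layer k) S
        ≡⟨ cong₂ _+_ (fourier-layer (suc k) S) (fourier-layer k S) ⟩
      kraw (weight S) (zeros S) (suc k) + kraw (weight S) (zeros S) k
        ≡⟨ kraw-suc (weight S) (zeros S) k ⟨
      kraw (weight S) (suc (zeros S)) (suc k) ∎
      where open ≡-Reasoning

    λ₁≤fourier-w : ∀ S → λ₁ ≤ fourier w S
    λ₁≤fourier-w S = ≤-trans (kraw-1-minimal (suc k) (weight S) (zeros S) (weight+zeros S) 3+n≤2K)
      (≤-reflexive (sym (fourier-w S)))

    λ₁<fourier-w : ∀ S → ¬ Extremal S → λ₁ < fourier w S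
    λ₁<fourier-w S ¬ext with kraw-dichotomy (suc k) (weight S) (zeros S) (weight+zeros S) k<n 3+n≤2K
    ... | inj₁ ext = contradiction ext ¬ext
    ... | inj₂ lt  = subst (λ₁ <_) (sym (fourier-w S)) lt

    -- The sum of `w` is the valency, which is the eigenvalue at `𝟎`. The identity matches the edge
    -- bound `D` with the spectral bound `λ₁`.
    ∑w*D : ∑ (cube n) w * D ≡ + suc n * λ₁
    ∑w*D = begin
      ∑ (cube n) w * D
        ≡⟨ cong (_* D) (∑-cong (cube n)
          (λ z → trans (sym (*-identityʳ (w z))) (cong (w z *_) (sym (χ-𝟎ˡ z))))) ⟩
      fourier w 𝟎 * D               ≡⟨ cong (_* D) (fourier-w 𝟎) ⟩
      kraw (weight (𝟎 {n})) (suc (zeros (𝟎 {n}))) (suc k) * D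
        ≡⟨ cong₂ (λ a z → kraw a (suc z) (suc k) * D) (weight-𝟎 n)
          (trans (cong (ℕ._+ zeros (𝟎 {n})) (sym (weight-𝟎 n))) (weight+zeros (𝟎 {n}))) ⟩
      kraw 0 (suc n) (suc k) * D    ≡⟨ *-comm (kraw 0 (suc n) (suc k)) D ⟩
      D * kraw 0 (suc n) (suc k)    ≡⟨ kraw-1-eigenvalue n (suc k) ⟨
      + suc n * λ₁                  ∎
      where open ≡-Reasoning

    f : Fin (suc n) → Vec Bool n → ℤ
    f i x = sgn (lookup (evenLift (φ x)) i)

    -- The Gram matrix of the sign vectors of the lifted images.
    G : Vec Bool n → Vec Bool n → ℤ
    G x y = ∑ (coordinates (suc n)) (λ i → f i x * f i y)

    G-weight : ∀ x y → G x y ≡ + suc n -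
      (+ weight (evenLift (φ x ⊕ φ y)) + + weight (evenLift (φ x ⊕ φ y)))
    G-weight x y = begin
      G x y
        ≡⟨ ∑-cong (coordinates (suc n)) (sgn-lookup-⊕ (evenLift (φ x)) (evenLift (φ y))) ⟩
      ∑ (coordinates (suc n)) (λ i → sgn (lookup (evenLift (φ x) ⊕ evenLift (φ y)) i))
        ≡⟨ cong (λ u → ∑ (coordinates (suc n)) (λ i → sgn (lookup u i))) (evenLift-⊕ (φ x) (φ y)) ⟩
      ∑ (coordinates (suc n)) (λ i → sgn (lookup (evenLift (φ x ⊕ φ y)) i))
        ≡⟨ ∑-sgn-lookup (evenLift (φ x ⊕ φ y)) ⟩
      + suc n - (+ weight (evenLift (φ x ⊕ φ y)) + + weight (evenLift (φ x ⊕ φ y))) ∎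
      where open ≡-Reasoning

    f² : ∀ i x → f i x * f i x ≡ 1ℤ
    f² i x = sgn-square (lookup (evenLift (φ x)) i)

    G-diagonal : ∀ x → G x x ≡ + suc n
    G-diagonal x = begin
      G x x                                ≡⟨ ∑-cong (coordinates (suc n)) (λ i → f² i x) ⟩
      ∑ (coordinates (suc n)) (λ _ → 1ℤ)        ≡⟨ ∑-const (coordinates (suc n)) 1ℤ ⟩
      + length (coordinates (suc n)) * 1ℤ       ≡⟨ cong (λ m → + m * 1ℤ) (length-coordinates (suc n)) ⟩
      + suc n * 1ℤ                         ≡⟨ *-identityʳ (+ suc n) ⟩
      + suc n                              ∎
      where open ≡-Reasoning

    -- `φ` keeps the distance at least `k`, and the parity bit raises it to `suc k`.
    G-edge : ∀ x z → k ℕ.≤ weight z → G x (x ⊕ z) ≤ D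
    G-edge x z k≤w = ≤-trans (≤-reflexive (G-weight x (x ⊕ z)))
      (+-monoʳ-≤ (+ suc n) (neg-mono-≤ (+-mono-≤ (+≤+ K≤) (+≤+ K≤))))
      where
      K≤ : suc k ℕ.≤ weight (evenLift (φ x ⊕ φ (x ⊕ z)))
      K≤ = weight-evenLift (φ x ⊕ φ (x ⊕ z)) k-odd
        (φ-hom (subst (λ y → k ℕ.≤ weight y) (sym (⊕-cancelˡ x z)) k≤w))

    w-*-mono : ∀ z {a b} → (k ℕ.≤ weight z → a ≤ b) → w z * a ≤ w z * b
    w-*-mono z {a} {b} a≤b = begin
      w z * a                              ≡⟨ *-distribʳ-+ a (layer (suc k) z) (layer k z) ⟩
      layer (suc k) z * a + layer k z * a
        ≤⟨ +-mono-≤ (layer-*-mono (suc k) z (λ eq → a≤b (ℕ.<⇒≤ (ℕ.≤-reflexive (sym eq)))))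
                                                       (layer-*-mono k z (λ eq → a≤b (ℕ.≤-reflexive
                                                         (sym eq)))) ⟩
      layer (suc k) z * b + layer k z * b  ≡⟨ *-distribʳ-+ b (layer (suc k) z) (layer k z) ⟨
      w z * b                              ∎
      where open ≤-Reasoning

    -- Exchanging the sums over coordinates and over the cube turns the first part into a
    -- `w`-weighted sum of entries of `G` along edges. `G-edge` bounds it by the valency times `D`,
    -- which equals the second part, `suc n` times `λ₁`.
    local-energy : ∀ x → ∑ (coordinates (suc n)) (λ i → f i x * (convolve w (f i) x - λ₁ * f i x)) ≤ 0ℤ
    local-energy x = begin
      ∑ (coordinates (suc n)) (λ i → f i x * (convolve w (f i) x - λ₁ * f i x))
        ≡⟨ ∑-cong (coordinates (suc n)) (λ i → expand (f i x) (convolve w (f i) x) λ₁) ⟩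
      ∑ (coordinates (suc n)) (λ i → f i x * convolve w (f i) x - λ₁ * (f i x * f i x))
        ≡⟨ ∑-- (coordinates (suc n)) (λ i → f i x * convolve w (f i) x) (λ i → λ₁ * (f i x * f i x)) ⟩
      ∑ (coordinates (suc n)) (λ i → f i x * convolve w (f i) x) - ∑ (coordinates (suc n))
        (λ i → λ₁ * (f i x * f i x))
        ≡⟨ cong₂ _-_ convolution (trans (∑-*ˡ (coordinates (suc n)) λ₁ (λ i → f i x * f i x))
          (trans (cong (λ₁ *_) (G-diagonal x)) (*-comm λ₁ (+ suc n)))) ⟩
      ∑ (cube n) (λ z → w z * G x (x ⊕ z)) - + suc n * λ₁
        ≤⟨ +-monoˡ-≤ (- (+ suc n * λ₁)) (∑-mono (cube n) (λ z → w-*-mono z (G-edge x z))) ⟩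
      ∑ (cube n) (λ z → w z * D) - + suc n * λ₁
        ≡⟨ cong (_- + suc n * λ₁) (trans (∑-*ʳ (cube n) D w) ∑w*D) ⟩
      + suc n * λ₁ - + suc n * λ₁
        ≡⟨ +-inverseʳ (+ suc n * λ₁) ⟩
      0ℤ ∎
      where
      open ≤-Reasoning
      expand : ∀ a c l → a * (c - l * a) ≡ a * c - l * (a * a)
      expand = solve-∀
      swap : ∀ a b c → a * (b * c) ≡ b * (a * c)
      swap = solve-∀
      convolution : ∑ (coordinates (suc n)) (λ i → f i x * convolve w (f i) x) ≡ ∑ (cube n)
        (λ z → w z * G x (x ⊕ z))
      convolution = trans
        (∑-cong (coordinates (suc n)) (λ i → trans (sym (∑-*ˡ (cube n) (f i x) (λ z → w z * f i (x ⊕ z))))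
          (∑-cong (cube n) (λ z → swap (f i x) (w z) (f i (x ⊕ z))))))
        (trans (∑-swap (coordinates (suc n)) (cube n) (λ i z → w z * (f i x * f i (x ⊕ z))))
               (∑-cong (cube n) (λ z → ∑-*ˡ (coordinates (suc n)) (w z) (λ i → f i x * f i (x ⊕ z)))))

    energy : Fin (suc n) → Vec Bool n → ℤ
    energy i S = (fourier w S - λ₁) * (fourier (f i) S * fourier (f i) S)

    energy-nonneg : ∀ i S → 0ℤ ≤ energy i S
    energy-nonneg i S = *-mono-nonneg {fourier w S - λ₁} {fourier (f i) S * fourier (f i) S}
      (i≤j⇒0≤j-i {λ₁} {fourier w S} (λ₁≤fourier-w S)) (square-nonneg (fourier (f i) S))
      where
      *-mono-nonneg : ∀ {a b} → 0ℤ ≤ a → 0ℤ ≤ b → 0ℤ ≤ a * b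
      *-mono-nonneg {a} {b} 0≤a 0≤b =
        ≤-trans (≤-reflexive (sym (*-zeroʳ a))) (*-monoˡ-≤-nonNeg a {{nonNegative 0≤a}} 0≤b)

    -- The local bounds, summed over `x` and carried to the Fourier side. As each `energy i S` is
    -- nonnegative, all of them must vanish.
    total-energy : ∑ (coordinates (suc n)) (λ i → ∑ (cube n) (energy i)) ≤ 0ℤ
    total-energy = begin
      ∑ (coordinates (suc n)) (λ i → ∑ (cube n) (energy i))
        ≡⟨ ∑-cong (coordinates (suc n)) (λ i → fourier-energy w (f i) λ₁) ⟩
      ∑ (coordinates (suc n)) (λ i → (+ 2) ^ n * ∑ (cube n) (λ x → term i x))
        ≡⟨ ∑-*ˡ (coordinates (suc n)) ((+ 2) ^ n) (λ i → ∑ (cube n) (λ x → term i x)) ⟩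
      (+ 2) ^ n * ∑ (coordinates (suc n)) (λ i → ∑ (cube n) (λ x → term i x))
        ≡⟨ cong ((+ 2) ^ n *_) (∑-swap (coordinates (suc n)) (cube n) term) ⟩
      (+ 2) ^ n * ∑ (cube n) (λ x → ∑ (coordinates (suc n)) (λ i → term i x))
        ≤⟨ *-monoˡ-≤-nonNeg ((+ 2) ^ n) {{nonNegative (<⇒≤ (2^n-pos n))}} (∑-mono (cube n) local-energy) ⟩
      (+ 2) ^ n * ∑ (cube n) (λ _ → 0ℤ)
        ≡⟨ cong ((+ 2) ^ n *_) (∑-zero (cube n) (λ _ → refl)) ⟩
      (+ 2) ^ n * 0ℤ
        ≡⟨ *-zeroʳ ((+ 2) ^ n) ⟩
      0ℤ ∎
      where
      open ≤-Reasoning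
      term : Fin (suc n) → Vec Bool n → ℤ
      term i x = f i x * (convolve w (f i) x - λ₁ * f i x)

    energy≡0 : ∀ i S → energy i S ≡ 0ℤ
    energy≡0 i S = ∑-nonneg-≤0 (cube n) {energy i} (λ {S} _ → energy-nonneg i S)
      (≤-reflexive (∑-nonneg-≤0 (coordinates (suc n)) {λ i → ∑ (cube n) (energy i)}
        (λ {i} _ → ∑-nonneg (cube n) {energy i} (λ {S} _ → energy-nonneg i S)) total-energy
          (∈-coordinates i)))
      (∈-cube S)

    extremal? : (S : Vec Bool n) → Dec (Extremal S)
    extremal? S = (weight S ℕ.≟ 1) ⊎-dec (zeros S ℕ.≟ 0)

    support : ∀ i S → fourier (f i) S ≢ 0ℤ → Extremal S
    support i S f̂S≢0 with extremal? S
    ... | yes ext = ext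
    ... | no ¬ext = contradiction
      (gap-square≡0 λ₁ (fourier w S) (fourier (f i) S) (λ₁<fourier-w S ¬ext) (energy≡0 i S)) f̂S≢0

    abstract
      character : ∀ i → ∃[ b ] Extremal b × (∀ x → f i x * χ b x ≡ f i 𝟎)
      character i = sidon-character (f i) (f² i) (support i) (extremal-sidon 4≤n)

    b : Fin (suc n) → Vec Bool n
    b i = proj₁ (character i)

    b-extremal : ∀ i → Extremal (b i)
    b-extremal i = proj₁ (proj₂ (character i))

    f-product : ∀ i x y → f i x * f i y ≡ χ (b i) (x ⊕ y)
    f-product i = character-product (f i) (b i) (f² i 𝟎) (proj₂ (proj₂ (character i)))

    -- Tightness and injectivity

    g : Vec Bool n → ℤ
    g z = ∑ (coordinates (suc n)) (λ i → χ (b i) z)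

    -- By `f-product`, `g z` is the entry `G 𝟎 z`.
    g-edge : ∀ z → k ℕ.≤ weight z → g z ≤ D
    g-edge z k≤w = ≤-trans (≤-reflexive
      (∑-cong (coordinates (suc n)) (λ i → trans (cong (χ (b i)) (sym (⊕-cancelˡ 𝟎 z)))
      (sym (f-product i 𝟎 (𝟎 ⊕ z))))))
      (G-edge 𝟎 z k≤w)

    slack-nonneg : ∀ z → 0ℤ ≤ w z * D - w z * g z
    slack-nonneg z = i≤j⇒0≤j-i (w-*-mono z (g-edge z))

    -- The `w`-weighted sum of `g` is a sum of `suc n` eigenvalues, each at least `λ₁`, while that
    -- of `D` is `suc n` times `λ₁`. So the nonnegative slacks have no room.
    total-slack : ∑ (cube n) (λ z → w z * D - w z * g z) ≤ 0ℤ
    total-slack = begin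
      ∑ (cube n) (λ z → w z * D - w z * g z)
        ≡⟨ ∑-- (cube n) (λ z → w z * D) (λ z → w z * g z) ⟩
      ∑ (cube n) (λ z → w z * D) - ∑ (cube n) (λ z → w z * g z)
        ≡⟨ cong₂ _-_ (trans (∑-*ʳ (cube n) D w) ∑w*D) spectral ⟩
      + suc n * λ₁ - ∑ (coordinates (suc n)) (λ i → fourier w (b i))
        ≤⟨ +-monoʳ-≤ (+ suc n * λ₁) (neg-mono-≤
          (∑-mono (coordinates (suc n)) (λ i → λ₁≤fourier-w (b i)))) ⟩
      + suc n * λ₁ - ∑ (coordinates (suc n)) (λ _ → λ₁)
        ≡⟨ cong (λ t → + suc n * λ₁ - t)
          (trans (∑-const (coordinates (suc n)) λ₁)
          (cong (λ m → + m * λ₁) (length-coordinates (suc n)))) ⟩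
      + suc n * λ₁ - + suc n * λ₁
        ≡⟨ +-inverseʳ (+ suc n * λ₁) ⟩
      0ℤ ∎
      where
      open ≤-Reasoning
      spectral : ∑ (cube n) (λ z → w z * g z) ≡ ∑ (coordinates (suc n)) (λ i → fourier w (b i))
      spectral = trans (∑-cong (cube n) (λ z → sym (∑-*ˡ (coordinates (suc n)) (w z) (λ i → χ (b i) z))))
        (∑-swap (cube n) (coordinates (suc n)) (λ z i → w z * χ (b i) z))

    w-pos : ∀ z → weight z ≡ suc k ⊎ weight z ≡ k → 0ℤ < w z
    w-pos z (inj₁ eq) = +-mono-<-≤ (subst (0ℤ <_) (sym (layer-≡ z eq)) (+<+ (s≤s z≤n))) (layer-nonneg k z)
    w-pos z (inj₂ eq) = +-mono-≤-< (layer-nonneg (suc k) z)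
      (subst (0ℤ <_) (sym (layer-≡ z eq)) (+<+ (s≤s z≤n)))

    g-tight : ∀ z → weight z ≡ suc k ⊎ weight z ≡ k → g z ≡ D
    g-tight z wz = sym (*-cancelˡ-≡ (w z) D (g z) {{≢-nonZero (λ eq → <⇒≢ (w-pos z wz) (sym eq))}}
      (i-j≡0⇒i≡j (w z * D) (w z * g z)
        (∑-nonneg-≤0 (cube n) {λ z → w z * D - w z * g z} (λ {z} _ → slack-nonneg z) total-slack
        (∈-cube z))))

    -- Both z and unit a ⊕ z satisfy the hypothesis of g-tight, and passing from one to the other only
    -- changes χ (unit a) and χ 𝟏, in opposite directions.
    module Exchange (a : Fin n) where

      -- Since coordinate `a` is set, toggling it moves `z` from layer `suc k` to layer `k`.
      witness : ∃[ z ] lookup z a ≡ true × weight z ≡ suc k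
      witness = weight-exists-at a k k<n

      z z′ : Vec Bool n
      z  = proj₁ witness
      z′ = unit a ⊕ z

      weight-z : weight z ≡ suc k
      weight-z = proj₂ (proj₂ witness)

      weight-z′ : weight z′ ≡ k
      weight-z′ = ℕ.suc-injective (trans (weight-unit⊕-clear a z (proj₁ (proj₂ witness))) weight-z)

      δ : Vec Bool n → ℤ
      δ S = χ S z - χ S z′

      ∑δ≡0 : ∑ (coordinates (suc n)) (λ i → δ (b i)) ≡ 0ℤ
      ∑δ≡0 = trans (∑-- (coordinates (suc n)) (λ i → χ (b i) z) (λ i → χ (b i) z′))
        (i≡j⇒i-j≡0 (trans (g-tight z (inj₁ weight-z)) (sym (g-tight z′ (inj₂ weight-z′)))))

      δ-sgn : ∀ S → δ S ≡ χ S z - sgn (lookup S a) * χ S z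
      δ-sgn S = cong (λ t → χ S z - t)
        (trans (χ-⊕ʳ S (unit a) z) (cong (_* χ S z) (trans (χ-sym S (unit a)) (χ-unit a S))))

      δ-unit : δ (unit a) ≡ -[1+ 1 ]
      δ-unit = trans (δ-sgn (unit a)) (cong₂ (λ s t → s - sgn t * s)
        (trans (χ-unit a z) (cong sgn (proj₁ (proj₂ witness)))) (lookup-unit-same a))

      δ-𝟏 : δ 𝟏 ≡ + 2
      δ-𝟏 = trans (δ-sgn 𝟏) (cong₂ (λ s t → s - sgn t * s) χ-𝟏-z (lookup-replicate a true))
        where
        χ-𝟏-z : χ 𝟏 z ≡ 1ℤ
        -- The weight `suc k` of `z` is even.
        χ-𝟏-z = trans (χ-𝟏 z) (trans (sym (parity-weight z))
          (trans (cong parity weight-z) (cong -_ k-odd)))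

      δ-other : ∀ {c} → c ≢ a → δ (unit c) ≡ 0ℤ
      δ-other {c} c≢a = trans (δ-sgn (unit c)) (trans
        (cong (λ t → χ (unit c) z - sgn t * χ (unit c) z) (lookup-unit-other c≢a))
          (cancel (χ (unit c) z)))
        where
        cancel : ∀ t → t - 1ℤ * t ≡ 0ℤ
        cancel = solve-∀

      δ<0⇒unit : ∀ S → UnitOr𝟏 S → δ S < 0ℤ → S ≡ unit a
      δ<0⇒unit _ (inj₂ refl) δ<0 with +<+ () ← subst (_< 0ℤ) δ-𝟏 δ<0
      δ<0⇒unit _ (inj₁ (c , refl)) δ<0 with c Fin.≟ a
      ... | yes c≡a = cong unit c≡a
      ... | no  c≢a = contradiction (δ-other c≢a) (<⇒≢ δ<0)

      δ>0⇒𝟏 : ∀ S → UnitOr𝟏 S → 0ℤ < δ S → S ≡ 𝟏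
      δ>0⇒𝟏 _ (inj₂ refl) _ = refl
      δ>0⇒𝟏 _ (inj₁ (c , refl)) δ>0 with c Fin.≟ a
      ... | no  c≢a  = contradiction (sym (δ-other c≢a)) (<⇒≢ δ>0)
      ... | yes refl with () ← subst (0ℤ <_) δ-unit δ>0

      -- The `δ (b i)` sum to zero, so the term -2 at `unit a` must be balanced by a positive one,
      -- and only `𝟏` gives a positive value.
      unit⇒𝟏 : ∀ i → b i ≡ unit a → ∃[ j ] b j ≡ 𝟏
      unit⇒𝟏 i bi≡ = map₂ (λ {j} → hit j)
        (∑≤0⇒∃<0 (coordinates (suc n)) {λ i → - δ (b i)} (≤-reflexive ∑-δ≡0) (∈-coordinates i) 0<-δ)
        where
        ∑-δ≡0 : ∑ (coordinates (suc n)) (λ i → - δ (b i)) ≡ 0ℤ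
        ∑-δ≡0 = trans (∑-cong (coordinates (suc n)) (λ i → sym (-1*i≡-i (δ (b i)))))
          (trans (∑-*ˡ (coordinates (suc n)) -1ℤ (λ i → δ (b i))) (cong (-1ℤ *_) ∑δ≡0))
        0<-δ : 0ℤ < - δ (b i)
        0<-δ = subst (0ℤ <_) (sym (cong -_ (trans (cong δ bi≡) δ-unit))) (+<+ (s≤s z≤n))
        hit : ∀ j → - δ (b j) < 0ℤ → b j ≡ 𝟏
        hit j -δ<0 = δ>0⇒𝟏 (b j) (extremal-shape (b j) (b-extremal j))
          (subst (0ℤ <_) (neg-involutive (δ (b j))) (neg-mono-< -δ<0))

      𝟏⇒unit : ∀ i → b i ≡ 𝟏 → ∃[ j ] b j ≡ unit a
      𝟏⇒unit i bi≡ = map₂ (λ {j} → δ<0⇒unit (b j) (extremal-shape (b j) (b-extremal j)))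
        (∑≤0⇒∃<0 (coordinates (suc n)) {λ i → δ (b i)} (≤-reflexive ∑δ≡0) (∈-coordinates i)
          (subst (0ℤ <_) (sym (trans (cong δ bi≡) δ-𝟏)) (+<+ (s≤s z≤n))))

    open Exchange

    -- Any single `b i` starts the exchange: it is `𝟏`, or a unit vector from which `𝟏` is reached.
    -- From `𝟏`, `𝟏⇒unit` then reaches every unit vector.
    b-hits-𝟏 : ∃[ i ] b i ≡ 𝟏
    b-hits-𝟏 with extremal-shape (b zero) (b-extremal zero)
    ... | inj₁ (c , b₀≡) = unit⇒𝟏 c zero b₀≡
    ... | inj₂ b₀≡       = zero , b₀≡

    b-hits-unit : ∀ a → ∃[ i ] b i ≡ unit a
    b-hits-unit a = 𝟏⇒unit a (proj₁ b-hits-𝟏) (proj₂ b-hits-𝟏)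

    -- If the images agree, then every `χ (b i)` is 1 at `x ⊕ y`. Those with `b i` a unit vector
    -- read off each coordinate of `x ⊕ y`.
    φ-injective : ∀ {x y} → φ x ≡ φ y → x ≡ y
    φ-injective {x} {y} φx≡φy = ⊕≡𝟎⇒≡ x y (lookup-ext-𝟎 (x ⊕ y) vanish)
      where
      vanish : ∀ a → lookup (x ⊕ y) a ≡ false
      vanish a = sgn≡1 (lookup (x ⊕ y) a) (begin
        sgn (lookup (x ⊕ y) a)  ≡⟨ χ-unit a (x ⊕ y) ⟨
        χ (unit a) (x ⊕ y)      ≡⟨ cong (λ S → χ S (x ⊕ y)) bi≡ ⟨
        χ (b i) (x ⊕ y)         ≡⟨ f-product i x y ⟨
        f i x * f i y           ≡⟨ cong (λ u → f i x * sgn (lookup (evenLift u) i)) φx≡φy ⟨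
        f i x * f i x           ≡⟨ f² i x ⟩
        1ℤ                      ∎)
        where
        open ≡-Reasoning
        i : Fin (suc n)
        i = proj₁ (b-hits-unit a)
        bi≡ : b i ≡ unit a
        bi≡ = proj₂ (b-hits-unit a)
        sgn≡1 : ∀ b → sgn b ≡ 1ℤ → b ≡ false
        sgn≡1 false _ = refl

open Spectral
open import Data.Integer.Base using (ℤ; 1ℤ; -1ℤ; -_)
open import Data.Nat.Base using (_+_; _*_; _∸_; _≤_; _<_)

-- Graphs

infixr 9 _∘ʰ_
_∘ʰ_ : ∀ {G H K} → H ⟶ K → G ⟶ H → G ⟶ K
g ∘ʰ f = record
  { map       = _⟶_.map g ∘ _⟶_.map f
  ; preserves = _⟶_.preserves g ∘ _⟶_.preserves f
  }

inclusion : ∀ {G} (S : Subgraph G) → Subgraph.graph S ⟶ G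
inclusion S = record { map = proj₁ ; preserves = Subgraph.∼ₛ⇒∼ S }

Finite-injective⇒≤ : ∀ {A B} (finA : Finite A) (finB : Finite B) {f : A → B} →
                     Injective _≡_ _≡_ f → proj₁ finA ≤ proj₁ finB
Finite-injective⇒≤ (_ , Fin↔A) (_ , Fin↔B) {f} f-inj =
  Fin.injective⇒≤ {f = Inverse.from Fin↔B ∘ f ∘ Inverse.to Fin↔A}
    (Injection.injective (↔⇒↣ Fin↔A) ∘ f-inj ∘ Injection.injective (↔⇒↣ (↔-sym Fin↔B)))

order-mono : ∀ G H {f : Graph.Vertex G → Graph.Vertex H} →
             Injective _≡_ _≡_ f → Graph.order G ≤ Graph.order H
order-mono G H = Finite-injective⇒≤ (Graph.finite G) (Graph.finite H)

fold-cancel : ∀ {A : Set} {f : A → A} → Injective _≡_ _≡_ f →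
              ∀ x i d → fold x f i ≡ fold x f (i + d) → x ≡ fold x f d
fold-cancel f-inj x zero    d eq = eq
fold-cancel f-inj x (suc i) d eq = fold-cancel f-inj x i d (f-inj eq)

-- By pigeonhole two iterates agree, and cancelling `f` brings the orbit back to `x` itself.
injective⇒periodic : ∀ {A} → Finite A → {f : A → A} → Injective _≡_ _≡_ f →
                     ∀ x → ∃[ m ] fold x f (suc m) ≡ x
injective⇒periodic (N , Fin↔A) {f} f-inj x
  with i , j , i<j , eq ← Fin.pigeonhole (ℕ.n<1+n N) (λ i → Inverse.from Fin↔A (fold x f (toℕ i)))
  with d , i+1+d≡j ← ℕ.m≤n⇒∃[o]m+o≡n i<j
  = d , sym (fold-cancel f-inj x (toℕ i) (suc d)
    (trans from-inj (cong (fold x f) (trans (sym i+1+d≡j) (sym (ℕ.+-suc (toℕ i) d))))))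
  where
  from-inj : fold x f (toℕ i) ≡ fold x f (toℕ j)
  from-inj = Injection.injective (↔⇒↣ (↔-sym Fin↔A)) eq

-- A preimage of a vertex is its predecessor on its periodic orbit. Edges are reflected because the
-- orbit of a pair returns to it, and every further application of the map keeps an edge.
injective⇒isomorphism : ∀ {G} (f : G ⟶ G) → Injective _≡_ _≡_ (_⟶_.map f) → IsIsomorphism f
injective⇒isomorphism {G} f f-inj = (f-inj , surjective) , reflects
  where
  open Graph G
  open _⟶_ f renaming (map to φ)
  surjective : ∀ y → ∃[ x ] (∀ {z} → z ≡ x → φ z ≡ y)
  surjective y with m , periodic ← injective⇒periodic finite f-inj y = fold y φ m , λ { refl → periodic }
  φ² : Vertex × Vertex → Vertex × Vertex
  φ² = Product.map φ φ
  Edge : Vertex × Vertex → Set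
  Edge (x , y) = x ∼ y
  edge-orbit : ∀ p m → Edge (φ² p) → Edge (fold p φ² (suc m))
  edge-orbit p zero    e = e
  edge-orbit p (suc m) e = preserves (edge-orbit p m e)
  reflects : ∀ {x y} → φ x ∼ φ y → x ∼ y
  reflects {x} {y} e with m , periodic ← injective⇒periodic (finite-× finite finite) {φ²}
      (λ eq → cong₂ _,_ (f-inj (proj₁ (,-injective eq))) (f-inj (proj₂ (,-injective eq)))) (x , y)
    = subst Edge periodic (edge-orbit (x , y) m e)

Q-isCore : ∀ {n k} .{{_ : NonZero k}} → parity k ≡ -1ℤ → k < n → n < k + k → IsCore (Q n k)
Q-isCore k-odd k<n n<2k f = injective⇒isomorphism f
  (Endomorphism.φ-injective k-odd k<n n<2k (_⟶_.map f) (λ {x} {y} → _⟶_.preserves f {x} {y}))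

-- The even-weight copy of the smaller graph

module ParityBit (n k : ℕ) .{{k≢0 : NonZero k}} .{{1+k≢0 : NonZero (suc k)}} where

  weight-tail : ∀ (x y : Vec Bool (suc n)) → suc k ≤ weight (x ⊕ y) → k ≤ weight (tail x ⊕ tail y)
  weight-tail (b ∷ x) (c ∷ y) 1+k≤w = ℕ.≤-pred (ℕ.≤-trans 1+k≤w (weight-∷-≤ (b xor c)))
    where
    weight-∷-≤ : ∀ b → weight (b ∷ (x ⊕ y)) ≤ suc (weight (x ⊕ y))
    weight-∷-≤ true  = ℕ.≤-refl
    weight-∷-≤ false = ℕ.n≤1+n _

  dropHom : (Q (suc n) (suc k) {{1+k≢0}}) ⟶ (Q n k {{k≢0}})
  dropHom = record { map = tail ; preserves = λ {x} {y} → weight-tail x y }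

  module _ (k-odd : parity k ≡ -1ℤ) where

    evenLift-preserves : ∀ x y → k ≤ weight {n} (x ⊕ y) → suc k ≤ weight (evenLift x ⊕ evenLift y)
    evenLift-preserves x y k≤w = subst (λ v → suc k ≤ weight v) (sym (evenLift-⊕ x y))
      (weight-evenLift (x ⊕ y) k-odd k≤w)

    liftHom : (Q n k {{k≢0}}) ⟶ (Q (suc n) (suc k) {{1+k≢0}})
    liftHom = record { map = evenLift ; preserves = λ {x} {y} → evenLift-preserves x y }

    -- The induced subgraph on the vectors of even weight.
    evenSubgraph : Subgraph (Q (suc n) (suc k) {{1+k≢0}})
    evenSubgraph = record
      { member = not ∘ odd
      ; _∼ₛ_   = λ u v → suc k ≤ weight (proj₁ u ⊕ proj₁ v)
      ; ∼ₛ-sym = λ {u} {v} → Graph.∼-sym (Q (suc n) (suc k) {{1+k≢0}}) {proj₁ u} {proj₁ v}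
      ; ∼ₛ⇒∼   = λ e → e
      }

    evenLift-even : ∀ (x : Vec Bool n) → T (not (odd (evenLift x)))
    evenLift-even x = subst (T ∘ not) (sym (Bool.xor-same (odd x))) _

    even⇒evenLift : ∀ (v : Vec Bool (suc n)) → T (not (odd v)) → evenLift (tail v) ≡ v
    even⇒evenLift (b ∷ x) even = cong (_∷ x) (xor-even b (odd x) even)
      where
      xor-even : ∀ b c → T (not (b xor c)) → c ≡ b
      xor-even true  true  _ = refl
      xor-even false false _ = refl

    liftIso : (Q n k {{k≢0}}) ⟶ Subgraph.graph evenSubgraph
    liftIso = record
      { map       = λ x → evenLift x , evenLift-even x
      ; preserves = λ {x} {y} → evenLift-preserves x y
      }

    -- Evenness determines the first bit from the others, and membership proofs are irrelevant.
    even-≡ : ∀ {u v : Vec Bool (suc n)} {s : T (not (odd u))} {t : T (not (odd v))} →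
             tail u ≡ tail v → _≡_ {A = Graph.Vertex (Subgraph.graph evenSubgraph)} (u , s) (v , t)
    even-≡ {u} {v} {s} {t} eq with trans (sym (even⇒evenLift u s))
      (trans (cong evenLift eq) (even⇒evenLift v t))
    ... | refl = cong (u ,_) (Bool.T-irrelevant s t)

    liftIso-isIsomorphism : IsIsomorphism liftIso
    liftIso-isIsomorphism =
      (cong (tail ∘ proj₁) , λ v → tail (proj₁ v) , λ { refl → even-≡ refl })
      , λ {x} {y} → weight-tail (evenLift x) (evenLift y)

    -- Lifting, applying `h`, including and dropping a bit is an endomorphism of a core, hence
    -- injective. So `h` is injective on the even vectors, which gives the count.
    even-minimal : IsCore (Q n k {{k≢0}}) → ∀ S → (Q (suc n) (suc k) {{1+k≢0}}) ⟶ Subgraph.graph S →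
                   Graph.order (Subgraph.graph evenSubgraph) ≤ Graph.order (Subgraph.graph S)
    even-minimal core S h = order-mono (Subgraph.graph evenSubgraph) (Subgraph.graph S)
      {_⟶_.map h ∘ proj₁} (λ {u} {v} eq → even-≡ (proj₁ (proj₁ (core endo)) (begin
        tail (proj₁ (_⟶_.map h (evenLift (tail (proj₁ u)))))
          ≡⟨ cong (tail ∘ proj₁ ∘ _⟶_.map h) (even⇒evenLift (proj₁ u) (proj₂ u)) ⟩
        tail (proj₁ (_⟶_.map h (proj₁ u)))                    ≡⟨ cong (tail ∘ proj₁) eq ⟩
        tail (proj₁ (_⟶_.map h (proj₁ v)))
          ≡⟨ cong (tail ∘ proj₁ ∘ _⟶_.map h) (even⇒evenLift (proj₁ v) (proj₂ v)) ⟨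
        tail (proj₁ (_⟶_.map h (evenLift (tail (proj₁ v)))))  ∎)))
      where
      open ≡-Reasoning
      endo : (Q n k {{k≢0}}) ⟶ (Q n k {{k≢0}})
      endo = dropHom ∘ʰ inclusion S ∘ʰ h ∘ʰ liftHom

    isCoreOf : IsCore (Q n k {{k≢0}}) → (Q n k {{k≢0}}) IsCoreOf (Q (suc n) (suc k) {{1+k≢0}})
    isCoreOf core =
      evenSubgraph , liftIso ∘ʰ dropHom , even-minimal core , liftIso , liftIso-isIsomorphism

-- Divisibility by 2 and the three cases

parity≡1⇒2∣ : ∀ k → parity k ≡ 1ℤ → 2 ∣ k
parity≡1⇒2∣ zero          _    = 2 ∣0
parity≡1⇒2∣ (suc (suc k)) even =
  ∣m∣n⇒∣m+n ∣-refl (parity≡1⇒2∣ k (trans (sym (ℤ.neg-involutive (parity k))) even))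

¬2∣⇒odd : ∀ k → ¬ (2 ∣ k) → parity k ≡ -1ℤ
¬2∣⇒odd k 2∤k with parity-dec k
... | inj₁ even = contradiction (parity≡1⇒2∣ k even) 2∤k
... | inj₂ odd  = odd

2∣1+k⇒odd : ∀ k → 2 ∣ suc k → parity k ≡ -1ℤ
2∣1+k⇒odd k (divides (suc q) refl) = cong -_ (even q)
  where
  even : ∀ q → parity (q * 2) ≡ 1ℤ
  even zero    = refl
  even (suc q) = trans (ℤ.neg-involutive (parity (q * 2))) (even q)

theorem4p14 : (n k : ℕ) .{{_ : NonZero k}} → k < n → n < 2 * k →
    (¬ (2 ∣ k) → IsCore (Q n k))
    × (n < 2 * k ∸ 1 → (2∣k : 2 ∣ k) →
    (Q (n ∸ 1) (k ∸ 1) {{even⇒pred-nonZero 2∣k}}) IsCoreOf (Q n k))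
    × (n ≡ 2 * k ∸ 1 → (2∣k : 2 ∣ k) →
    HomEquivalent (Q n k) (Q (n ∸ 1) (k ∸ 1) {{even⇒pred-nonZero 2∣k}}))
theorem4p14 (suc n) (suc k) {{1+k≢0}} (s≤s k<n) n<2k = odd-case , even-case , boundary-case
  where
  odd-case : ¬ (2 ∣ suc k) → IsCore (Q (suc n) (suc k) {{1+k≢0}})
  odd-case 2∤k = Q-isCore {suc n} {suc k} {{1+k≢0}} (¬2∣⇒odd (suc k) 2∤k) (s≤s k<n)
    (subst (λ m → suc n < suc k + m) (ℕ.+-identityʳ (suc k)) n<2k)

  even-case : suc n < 2 * suc k ∸ 1 → (2∣k : 2 ∣ suc k) →
              Q n k {{even⇒pred-nonZero {{1+k≢0}} 2∣k}} IsCoreOf Q (suc n) (suc k) {{1+k≢0}}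
  even-case n<2k-1 2∣k = ParityBit.isCoreOf n k {{even⇒pred-nonZero {{1+k≢0}} 2∣k}} {{1+k≢0}}
    (2∣1+k⇒odd k 2∣k)
    -- Here `n` and `k` are already the predecessors, so `k` is odd; the bound `suc n < suc (k + k)`
    -- yields the required `n < k + k`.
    (Q-isCore {n} {k} {{even⇒pred-nonZero {{1+k≢0}} 2∣k}} (2∣1+k⇒odd k 2∣k) k<n
      (ℕ.≤-pred (subst (suc n <_) 2k-1≡ n<2k-1)))
    where
    2k-1≡ : k + suc (k + 0) ≡ suc (k + k)
    2k-1≡ = trans (ℕ.+-suc k (k + 0)) (cong (λ m → suc (k + m)) (ℕ.+-identityʳ k))

  boundary-case : suc n ≡ 2 * suc k ∸ 1 → (2∣k : 2 ∣ suc k) →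
                  HomEquivalent (Q (suc n) (suc k) {{1+k≢0}}) (Q n k {{even⇒pred-nonZero {{1+k≢0}} 2∣k}})
  boundary-case _ 2∣k = ParityBit.dropHom n k {{even⇒pred-nonZero {{1+k≢0}} 2∣k}}
    {{1+k≢0}} , ParityBit.liftHom n k {{even⇒pred-nonZero {{1+k≢0}} 2∣k}} {{1+k≢0}} (2∣1+k⇒odd k 2∣k)
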